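{- Let $p,q$ be distinct odd primes with $n=pq$ equal to $3p$ (i.e. $q=3$), or $n=35$, or $n=55$. Then $$\{p^3m : m\in\mathbb Z,\ \gcd(m,q)=1\}\cup\{q^3m : m\in\mathbb Z,\ \gcd(m,p)=1\}\subseteq S_{pq}.$$
   Context: For a positive integer $n$, $S_n$ denotes the set of all $n\times n$ circulant determinants with integer entries, i.e. $S_n=\{\det(a_{(j-i)\bmod n})_{0\le i,j\le n-1} : (a_0,\dots,a_{n-1})\in\mathbb Z^n\}$. Equivalently $S_n=\{M_n(F): F\in\mathbb Z[x]\}$, where $M_n(F)=\prod_{j=1}^n F(\omega_n^j)$ and $\omega_n=e^{2\pi i/n}$. -}

module Defs where

open import Data.Nat as ℕ using (ℕ; zero; suc)
open import Data.Nat.DivMod using (_mod_)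
open import Data.Fin using (Fin; toℕ; punchIn) renaming (zero to fzero; suc to fsuc)
open import Data.Integer as ℤ using (ℤ; +_; -_)
open import Data.Product using (∃)
open import Relation.Binary.PropositionalEquality using (_≡_)

Σ-fin : ∀ n → (Fin n → ℤ) → ℤ
Σ-fin zero    f = + 0
Σ-fin (suc n) f = f fzero ℤ.+ Σ-fin n (λ j → f (fsuc j))

sign : ℕ → ℤ
sign zero    = + 1
sign (suc k) = - sign k

det : ∀ n → (Fin n → Fin n → ℤ) → ℤ
det zero    A = + 1
det (suc n) A =
  Σ-fin (suc n) (λ j → sign (toℕ j) ℤ.* (A fzero j ℤ.* det n (λ i k → A (fsuc i) (punchIn j k))))

circulant : ∀ n → (Fin n → ℤ) → Fin n → Fin n → ℤ
circulant zero    a () j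
circulant (suc k) a i j = a ((toℕ j ℕ.+ (suc k ℕ.∸ toℕ i)) mod (suc k))

InS : ℕ → ℤ → Set
InS n d = ∃ λ (a : Fin n → ℤ) → det n (circulant n a) ≡ d

{-# OPTIONS --safe #-}
module Submission where

-- Write n = pq and identify circulant matrices with ℤ[x]/(xⁿ - 1), so that the determinant of F is
-- the product of the values of F at the n-th roots of unity.  It suffices to find one F with
-- F(1) = p·a, gcd(a, q) = 1, with norm p² at the primitive p-th roots of unity and with unit values
-- at the primitive q-th and pq-th roots: the units 1 + x + … + xᵏ⁻¹, gcd(k, n) = 1, and multiples
-- of 1 + x + … + xⁿ⁻¹ then move F(1) to ±p·m for every m prime to q without changing the other
-- factors up to sign, and the sign is repaired by F ↦ -F because n is odd.
--
-- Roots of unity are avoided: for d ∣ n the matrix of F is conjugate to a block triangular one with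
-- diagonal blocks the matrix of F in ℤ[x]/(x^d - 1) and its action on the quotient by the vectors
-- of period d.  The determinant of the latter is multiplicative in F and ignores multiples of
-- 1 + x^d + x^{2d} + … + x^{n-d}, so it is ±1 as soon as F is invertible modulo that sum.
--
-- For the pair (3, p) take F = 1 + x³ + x⁶; for (p, 3) take the lift of (1 - x)³ / (1 - x³) from
-- ℤ[x]/(xᵖ - 1) that is 1 modulo 1 + xᵖ + x²ᵖ; for 35 and 55 a product of two units 1 - ζ, ζ of
-- order pq, can be corrected at the q-th roots of unity to a cyclotomic unit congruent to it.

open import Defs
open import Data.Nat using (ℕ; _*_; _^_)
open import Data.Nat.Divisibility using (_∣_)
open import Data.Nat.Primality using (Prime)
open import Data.Integer as ℤ using (ℤ; +_)
open import Data.Integer.GCD using (gcd)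
open import Data.Product using (_×_)
open import Data.Sum using (_⊎_)
open import Relation.Nullary using (¬_)
open import Relation.Binary.PropositionalEquality using (_≡_; _≢_)

open import Data.Nat as ℕ using (zero; suc; _+_; _∸_; _<_; _≤_; s≤s)
import Data.Nat.Properties as ℕₚ
open import Data.Nat.DivMod using (_mod_; _%_; _/_)
import Data.Nat.DivMod as DM
open import Data.Nat.Divisibility using (divides; _∣?_)
import Data.Nat.Divisibility as Dv
open import Data.Nat.Coprimality using (Coprime; coprime?; coprime-Bézout; coprime-divisor; gcd≡1⇒coprime)
import Data.Nat.Coprimality as Cop
open import Data.Nat.GCD using (module Bézout)
open import Data.Nat.Primality using (euclidsLemma; prime[2]; prime?; prime⇒irreducible; ¬prime[1])
open import Data.Nat.Tactic.RingSolver using () renaming (solve-∀ to ℕ-solve-∀)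
open import Data.Integer using (-[1+_]; 0ℤ; 1ℤ; -1ℤ) renaming (_+_ to _⊕_; _*_ to _⊗_; -_ to ⊖_; _-_ to _⊝_; ∣_∣ to abs)
import Data.Integer.Properties as ℤₚ
import Data.Integer.DivMod as ℤDM
import Data.Integer.Divisibility.Signed as ℤD
open import Data.Integer.Tactic.RingSolver using (solve-∀)
open import Data.Fin using (Fin; toℕ; fromℕ<; inject₁; punchIn; punchOut; _↑ˡ_; _↑ʳ_; splitAt) renaming (zero to fzero; suc to fsuc)
import Data.Fin.Properties as F
open import Data.Fin.Properties using (_≟_)
open import Data.List using (List; []; _∷_; take; drop)
open import Data.Product using (_,_; ∃; proj₁; proj₂)
open import Data.Sum using (inj₁; inj₂)
open import Relation.Nullary using (yes; no; contradiction)
open import Relation.Nullary.Decidable using (from-yes; from-no)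
open import Relation.Binary.Definitions using (Tri; tri<; tri≈; tri>)
open import Relation.Binary.PropositionalEquality using (refl; sym; trans; cong; cong₂; subst; module ≡-Reasoning)

open ≡-Reasoning

-- Finite sums and the Kronecker delta.

Σ-cong : ∀ n {f g : Fin n → ℤ} → (∀ i → f i ≡ g i) → Σ-fin n f ≡ Σ-fin n g
Σ-cong zero    f≗g = refl
Σ-cong (suc n) f≗g = cong₂ _⊕_ (f≗g fzero) (Σ-cong n (λ i → f≗g (fsuc i)))

Σ-zero : ∀ n {f : Fin n → ℤ} → (∀ i → f i ≡ 0ℤ) → Σ-fin n f ≡ 0ℤ
Σ-zero zero    f≗0 = refl
Σ-zero (suc n) f≗0 = cong₂ _⊕_ (f≗0 fzero) (Σ-zero n (λ i → f≗0 (fsuc i)))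

Σ-linear : ∀ n s t (f g : Fin n → ℤ) →
  Σ-fin n (λ i → s ⊗ f i ⊕ t ⊗ g i) ≡ s ⊗ Σ-fin n f ⊕ t ⊗ Σ-fin n g
Σ-linear zero    s t f g = sym (cong₂ _⊕_ (ℤₚ.*-zeroʳ s) (ℤₚ.*-zeroʳ t))
Σ-linear (suc n) s t f g = trans
  (cong ((s ⊗ f fzero ⊕ t ⊗ g fzero) ⊕_) (Σ-linear n s t (λ i → f (fsuc i)) (λ i → g (fsuc i))))
  (regroup s t (f fzero) (g fzero) _ _)
  where
  regroup : ∀ s t a b x y → (s ⊗ a ⊕ t ⊗ b) ⊕ (s ⊗ x ⊕ t ⊗ y) ≡ s ⊗ (a ⊕ x) ⊕ t ⊗ (b ⊕ y)
  regroup = solve-∀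

Σ-+ : ∀ n (f g : Fin n → ℤ) → Σ-fin n (λ i → f i ⊕ g i) ≡ Σ-fin n f ⊕ Σ-fin n g
Σ-+ zero    f g = refl
Σ-+ (suc n) f g = trans
  (cong ((f fzero ⊕ g fzero) ⊕_) (Σ-+ n (λ i → f (fsuc i)) (λ i → g (fsuc i))))
  (regroup (f fzero) (g fzero) _ _)
  where
  regroup : ∀ a b x y → (a ⊕ b) ⊕ (x ⊕ y) ≡ (a ⊕ x) ⊕ (b ⊕ y)
  regroup = solve-∀

Σ-*ˡ : ∀ n c (f : Fin n → ℤ) → Σ-fin n (λ i → c ⊗ f i) ≡ c ⊗ Σ-fin n f
Σ-*ˡ zero    c f = sym (ℤₚ.*-zeroʳ c)
Σ-*ˡ (suc n) c f = trans (cong (c ⊗ f fzero ⊕_) (Σ-*ˡ n c (λ i → f (fsuc i))))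
  (sym (ℤₚ.*-distribˡ-+ c (f fzero) _))

Σ-*ʳ : ∀ n c (f : Fin n → ℤ) → Σ-fin n (λ i → f i ⊗ c) ≡ Σ-fin n f ⊗ c
Σ-*ʳ n c f = trans (Σ-cong n (λ i → ℤₚ.*-comm (f i) c))
  (trans (Σ-*ˡ n c f) (ℤₚ.*-comm c _))

Σ-swap : ∀ m n (f : Fin m → Fin n → ℤ) →
  Σ-fin m (λ i → Σ-fin n (f i)) ≡ Σ-fin n (λ j → Σ-fin m (λ i → f i j))
Σ-swap zero    n f = sym (Σ-zero n (λ _ → refl))
Σ-swap (suc m) n f = trans
  (cong (Σ-fin n (f fzero) ⊕_) (Σ-swap m n (λ i → f (fsuc i))))
  (sym (Σ-+ n (f fzero) _))

Σ-split : ∀ r d (f : Fin (r + d) → ℤ) →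
  Σ-fin (r + d) f ≡ Σ-fin r (λ i → f (i ↑ˡ d)) ⊕ Σ-fin d (λ j → f (r ↑ʳ j))
Σ-split zero    d f = sym (ℤₚ.+-identityˡ _)
Σ-split (suc r) d f = trans
  (cong (f fzero ⊕_) (Σ-split r d (λ i → f (fsuc i))))
  (sym (ℤₚ.+-assoc (f fzero) _ _))

-- Recursion on both indices makes the first minor of `δ` reduce to `δ` by computation, which
-- `det-δ` relies on.
δ : ∀ {n} → Fin n → Fin n → ℤ
δ fzero    fzero    = 1ℤ
δ fzero    (fsuc j) = 0ℤ
δ (fsuc i) fzero    = 0ℤ
δ (fsuc i) (fsuc j) = δ i j

δ-refl : ∀ {n} (i : Fin n) → δ i i ≡ 1ℤ
δ-refl fzero    = refl
δ-refl (fsuc i) = δ-refl i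

δ-≢ : ∀ {n} {i j : Fin n} → i ≢ j → δ i j ≡ 0ℤ
δ-≢ {i = fzero}  {fzero}  i≢j = contradiction refl i≢j
δ-≢ {i = fzero}  {fsuc j} i≢j = refl
δ-≢ {i = fsuc i} {fzero}  i≢j = refl
δ-≢ {i = fsuc i} {fsuc j} i≢j = δ-≢ (λ i≡j → i≢j (cong fsuc i≡j))

δ-sym : ∀ {n} (i j : Fin n) → δ i j ≡ δ j i
δ-sym fzero    fzero    = refl
δ-sym fzero    (fsuc j) = refl
δ-sym (fsuc i) fzero    = refl
δ-sym (fsuc i) (fsuc j) = δ-sym i j

Σ-δˡ : ∀ n (i : Fin n) (f : Fin n → ℤ) → Σ-fin n (λ j → δ i j ⊗ f j) ≡ f i
Σ-δˡ (suc n) fzero    f = trans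
  (cong₂ _⊕_ (ℤₚ.*-identityˡ (f fzero)) (Σ-zero n (λ _ → refl)))
  (ℤₚ.+-identityʳ (f fzero))
Σ-δˡ (suc n) (fsuc i) f = trans (ℤₚ.+-identityˡ _) (Σ-δˡ n i (λ j → f (fsuc j)))

Σ-δʳ : ∀ n (i : Fin n) (f : Fin n → ℤ) → Σ-fin n (λ j → f j ⊗ δ j i) ≡ f i
Σ-δʳ n i f = trans
  (Σ-cong n (λ j → trans (ℤₚ.*-comm (f j) (δ j i)) (cong (_⊗ f j) (δ-sym j i))))
  (Σ-δˡ n i f)

-- Matrices and first properties of the determinant.

Mat : ℕ → Set
Mat n = Fin n → Fin n → ℤ

infix 4 _≋_
_≋_ : ∀ {n} → Mat n → Mat n → Set
A ≋ B = ∀ i k → A i k ≡ B i k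

infixl 7 _·_
_·_ : ∀ {n} → Mat n → Mat n → Mat n
_·_ {n} A B i k = Σ-fin n (λ j → A i j ⊗ B j k)

minor : ∀ {n} → Mat (suc n) → Fin (suc n) → Mat n
minor A j i k = A (fsuc i) (punchIn j k)

laplaceTerm : ∀ {n} → Mat (suc n) → Fin (suc n) → ℤ
laplaceTerm {n} A j = sign (toℕ j) ⊗ (A fzero j ⊗ det n (minor A j))

det-cong : ∀ n {A B : Mat n} → A ≋ B → det n A ≡ det n B
det-cong zero    A≋B = refl
det-cong (suc n) A≋B = Σ-cong (suc n) (λ j → cong (sign (toℕ j) ⊗_)
  (cong₂ _⊗_ (A≋B fzero j) (det-cong n (λ i k → A≋B (fsuc i) (punchIn j k)))))

det-δ : ∀ n → det n δ ≡ 1ℤ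
det-δ zero    = refl
det-δ (suc n) = trans
  (cong₂ _⊕_ (cong (λ z → 1ℤ ⊗ (1ℤ ⊗ z)) (det-δ n)) (Σ-zero n (λ j → ℤₚ.*-zeroʳ (sign (suc (toℕ j))))))
  refl

det-scale : ∀ n c (A : Mat n) → det n (λ i k → c ⊗ A i k) ≡ c ℤ.^ n ⊗ det n A
det-scale zero    c A = refl
det-scale (suc n) c A = trans
  (Σ-cong (suc n) (λ j → trans
    (cong (λ z → sign (toℕ j) ⊗ ((c ⊗ A fzero j) ⊗ z)) (det-scale n c (minor A j)))
    (regroup (sign (toℕ j)) c (A fzero j) (c ℤ.^ n) _)))
  (Σ-*ˡ (suc n) (c ℤ.^ suc n) (laplaceTerm A))
  where
  regroup : ∀ s c a e d → s ⊗ ((c ⊗ a) ⊗ (e ⊗ d)) ≡ (c ⊗ e) ⊗ (s ⊗ (a ⊗ d))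
  regroup = solve-∀

-- Uniqueness of alternating forms

-- The three matrices are related entrywise rather than through `_[_≔_]`, so that the property
-- applies directly to minors and to products.
LinearAt : ∀ {n} → (Mat n → ℤ) → Fin n → Set
LinearAt {n} h c = ∀ s t {A B M : Mat n} →
  (∀ i k → k ≢ c → M i k ≡ A i k) → (∀ i k → k ≢ c → M i k ≡ B i k) →
  (∀ i → M i c ≡ s ⊗ A i c ⊕ t ⊗ B i c) → h M ≡ s ⊗ h A ⊕ t ⊗ h B

AlternatingAt : ∀ {n} → (Mat n → ℤ) → Fin n → Fin n → Set
AlternatingAt {n} h c e = (A : Mat n) → (∀ i → A i c ≡ A i e) → h A ≡ 0ℤ

record AlternatingForm {n} (h : Mat n → ℤ) : Set where
  field
    respects    : ∀ {A B} → A ≋ B → h A ≡ h B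
    linear      : ∀ c → LinearAt h c
    alternating : ∀ {c e} → c ≢ e → AlternatingAt h c e

_[_≔_] : ∀ {n} → Mat n → Fin n → (Fin n → ℤ) → Mat n
(A [ c ≔ v ]) i k with k ≟ c
... | yes _ = v i
... | no  _ = A i k

≔-at : ∀ {n} (A : Mat n) c v i → (A [ c ≔ v ]) i c ≡ v i
≔-at A c v i with c ≟ c
... | yes _   = refl
... | no  c≢c = contradiction refl c≢c

≔-off : ∀ {n} (A : Mat n) c v i {k} → k ≢ c → (A [ c ≔ v ]) i k ≡ A i k
≔-off A c v i {k} k≢c with k ≟ c
... | yes k≡c = contradiction k≡c k≢c
... | no  _   = refl

module _ {n} {h : Mat n → ℤ} (respects : ∀ {A B} → A ≋ B → h A ≡ h B) (linear : ∀ c → LinearAt h c) where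

  additive : ∀ A c u v → h (A [ c ≔ (λ i → u i ⊕ v i) ]) ≡ h (A [ c ≔ u ]) ⊕ h (A [ c ≔ v ])
  additive A c u v = trans
    (linear c 1ℤ 1ℤ
      (λ i k k≢c → trans (≔-off A c _ i k≢c) (sym (≔-off A c u i k≢c)))
      (λ i k k≢c → trans (≔-off A c _ i k≢c) (sym (≔-off A c v i k≢c)))
      (λ i → trans (≔-at A c _ i) (sym (cong₂ _⊕_
        (trans (ℤₚ.*-identityˡ _) (≔-at A c u i))
        (trans (ℤₚ.*-identityˡ _) (≔-at A c v i))))))
    (cong₂ _⊕_ (ℤₚ.*-identityˡ (h (A [ c ≔ u ]))) (ℤₚ.*-identityˡ (h (A [ c ≔ v ]))))

  ≔-swap : ∀ (A : Mat n) {c e} → c ≢ e → ∀ u v → A [ c ≔ u ] [ e ≔ v ] ≋ A [ e ≔ v ] [ c ≔ u ]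
  ≔-swap A {c} {e} c≢e u v i k with k ≟ e in ke | k ≟ c in kc
  ... | yes refl | yes refl = contradiction refl c≢e
  ... | yes refl | no  k≢c  = sym (≔-at A k v i)
  ... | no  k≢e  | yes refl = ≔-at A k u i
  ... | no  k≢e  | no  k≢c  = trans (≔-off A c u i k≢c) (sym (≔-off A e v i k≢e))

  -- Polarization: put `u + v` into both columns and expand; the two terms with equal columns
  -- vanish, and so does the whole.
  swap-columns : ∀ {c e} → c ≢ e → AlternatingAt h c e → ∀ A u v →
    h (A [ c ≔ u ] [ e ≔ v ]) ≡ ⊖ h (A [ c ≔ v ] [ e ≔ u ])
  swap-columns {c} {e} c≢e alt A u v = ℤ-neg (h (A [ c ≔ u ] [ e ≔ v ])) (h (A [ c ≔ v ] [ e ≔ u ])) (begin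
      h (A [ c ≔ u ] [ e ≔ v ]) ⊕ h (A [ c ≔ v ] [ e ≔ u ])
        ≡⟨ sym (cong₂ _⊕_
             (trans (cong (_⊕ h (A [ c ≔ u ] [ e ≔ v ])) (twice u)) (ℤₚ.+-identityˡ (h (A [ c ≔ u ] [ e ≔ v ]))))
             (trans (cong (h (A [ c ≔ v ] [ e ≔ u ]) ⊕_) (twice v)) (ℤₚ.+-identityʳ (h (A [ c ≔ v ] [ e ≔ u ]))))) ⟩
      (h (A [ c ≔ u ] [ e ≔ u ]) ⊕ h (A [ c ≔ u ] [ e ≔ v ])) ⊕ (h (A [ c ≔ v ] [ e ≔ u ]) ⊕ h (A [ c ≔ v ] [ e ≔ v ]))
        ≡⟨ sym (cong₂ _⊕_ (additive (A [ c ≔ u ]) e u v) (additive (A [ c ≔ v ]) e u v)) ⟩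
      h (A [ c ≔ u ] [ e ≔ w ]) ⊕ h (A [ c ≔ v ] [ e ≔ w ])
        ≡⟨ cong₂ _⊕_ (respects (≔-swap A c≢e u w)) (respects (≔-swap A c≢e v w)) ⟩
      h (A [ e ≔ w ] [ c ≔ u ]) ⊕ h (A [ e ≔ w ] [ c ≔ v ])
        ≡⟨ sym (additive (A [ e ≔ w ]) c u v) ⟩
      h (A [ e ≔ w ] [ c ≔ w ])
        ≡⟨ respects (λ i k → sym (≔-swap A c≢e w w i k)) ⟩
      h (A [ c ≔ w ] [ e ≔ w ])
        ≡⟨ twice w ⟩
      0ℤ ∎)
    where
    w : Fin n → ℤ
    w i = u i ⊕ v i
    twice : ∀ v → h (A [ c ≔ v ] [ e ≔ v ]) ≡ 0ℤ
    twice v = alt _ (λ i → trans (≔-off (A [ c ≔ v ]) e v i c≢e)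
      (trans (≔-at A c v i) (sym (≔-at (A [ c ≔ v ]) e v i))))
    ℤ-neg : ∀ x y → x ⊕ y ≡ 0ℤ → x ≡ ⊖ y
    ℤ-neg x y eq = trans (add-sub x y) (trans (cong (_⊕ ⊖ y) eq) (ℤₚ.+-identityˡ (⊖ y)))
      where
      add-sub : ∀ x y → x ≡ (x ⊕ y) ⊕ ⊖ y
      add-sub = solve-∀

  ≔-zero : ∀ A c → h (A [ c ≔ (λ _ → 0ℤ) ]) ≡ 0ℤ
  ≔-zero A c = linear c 0ℤ 0ℤ {A [ c ≔ _ ]} {A [ c ≔ _ ]} (λ _ _ _ → refl) (λ _ _ _ → refl) (≔-at A c _)

  ≔-scale : ∀ A c s v → h (A [ c ≔ (λ i → s ⊗ v i) ]) ≡ s ⊗ h (A [ c ≔ v ])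
  ≔-scale A c s v = trans
    (linear c s 0ℤ {A [ c ≔ v ]} {A [ c ≔ v ]}
      (λ i k k≢c → trans (≔-off A c _ i k≢c) (sym (≔-off A c v i k≢c)))
      (λ i k k≢c → trans (≔-off A c _ i k≢c) (sym (≔-off A c v i k≢c)))
      (λ i → trans (≔-at A c _ i) (sym (trans (ℤₚ.+-identityʳ _) (cong (s ⊗_) (≔-at A c v i))))))
    (ℤₚ.+-identityʳ _)

  ≔-combination : ∀ A c m (w : Fin m → ℤ) (v : Fin m → Fin n → ℤ) →
    (∀ x → h (A [ c ≔ v x ]) ≡ 0ℤ) → h (A [ c ≔ (λ i → Σ-fin m (λ x → w x ⊗ v x i)) ]) ≡ 0ℤ
  ≔-combination A c zero    w v vanish = ≔-zero A c
  ≔-combination A c (suc m) w v vanish = trans (additive A c _ _)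
    (cong₂ _⊕_
      (trans (≔-scale A c (w fzero) (v fzero)) (trans (cong (w fzero ⊗_) (vanish fzero)) (ℤₚ.*-zeroʳ (w fzero))))
      (≔-combination A c m (λ x → w (fsuc x)) (λ x → v (fsuc x)) (λ x → vanish (fsuc x))))

-- The determinant as an alternating form.

-- In the expansion along the first row, the term of column `c` is linear through its entry, since
-- its minor omits that column; every other term is linear through its minor, by induction.
det-linear : ∀ {n} (c : Fin n) → LinearAt (det n) c
det-linear {suc n} c s t {A} {B} {M} M≗A M≗B Mc =
  trans (Σ-cong (suc n) term) (Σ-linear (suc n) s t (laplaceTerm A) (laplaceTerm B))
  where
  at : ∀ σ s t a b d → σ ⊗ ((s ⊗ a ⊕ t ⊗ b) ⊗ d) ≡ s ⊗ (σ ⊗ (a ⊗ d)) ⊕ t ⊗ (σ ⊗ (b ⊗ d))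
  at = solve-∀
  off : ∀ σ s t m d e → σ ⊗ (m ⊗ (s ⊗ d ⊕ t ⊗ e)) ≡ s ⊗ (σ ⊗ (m ⊗ d)) ⊕ t ⊗ (σ ⊗ (m ⊗ e))
  off = solve-∀
  term : ∀ j → laplaceTerm M j ≡ s ⊗ laplaceTerm A j ⊕ t ⊗ laplaceTerm B j
  term j with j ≟ c
  ... | yes refl = begin
    σ ⊗ (M fzero j ⊗ det n (minor M j))
      ≡⟨ cong (λ z → σ ⊗ (z ⊗ det n (minor M j))) (Mc fzero) ⟩
    σ ⊗ ((s ⊗ A fzero j ⊕ t ⊗ B fzero j) ⊗ det n (minor M j))
      ≡⟨ at σ s t (A fzero j) (B fzero j) _ ⟩
    s ⊗ (σ ⊗ (A fzero j ⊗ det n (minor M j))) ⊕ t ⊗ (σ ⊗ (B fzero j ⊗ det n (minor M j)))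
      ≡⟨ cong₂ (λ x y → s ⊗ (σ ⊗ (A fzero j ⊗ x)) ⊕ t ⊗ (σ ⊗ (B fzero j ⊗ y)))
           (det-cong n (λ i k → M≗A (fsuc i) (punchIn j k) (F.punchInᵢ≢i j k)))
           (det-cong n (λ i k → M≗B (fsuc i) (punchIn j k) (F.punchInᵢ≢i j k))) ⟩
    s ⊗ laplaceTerm A j ⊕ t ⊗ laplaceTerm B j ∎
    where σ = sign (toℕ j)
  ... | no j≢c = begin
    σ ⊗ (M fzero j ⊗ det n (minor M j))
      ≡⟨ cong (λ z → σ ⊗ (M fzero j ⊗ z)) (det-linear c′ s t
           (λ i k k≢c′ → M≗A (fsuc i) (punchIn j k) (punch≢ k≢c′))
           (λ i k k≢c′ → M≗B (fsuc i) (punchIn j k) (punch≢ k≢c′))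
           (λ i → subst (λ e → M (fsuc i) e ≡ s ⊗ A (fsuc i) e ⊕ t ⊗ B (fsuc i) e) (sym c≡) (Mc (fsuc i)))) ⟩
    σ ⊗ (M fzero j ⊗ (s ⊗ det n (minor A j) ⊕ t ⊗ det n (minor B j)))
      ≡⟨ off σ s t (M fzero j) _ _ ⟩
    s ⊗ (σ ⊗ (M fzero j ⊗ det n (minor A j))) ⊕ t ⊗ (σ ⊗ (M fzero j ⊗ det n (minor B j)))
      ≡⟨ cong₂ (λ x y → s ⊗ (σ ⊗ (x ⊗ det n (minor A j))) ⊕ t ⊗ (σ ⊗ (y ⊗ det n (minor B j))))
           (M≗A fzero j j≢c) (M≗B fzero j j≢c) ⟩
    s ⊗ laplaceTerm A j ⊕ t ⊗ laplaceTerm B j ∎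
    where
    σ = sign (toℕ j)
    c′ : Fin n
    c′ = punchOut j≢c
    c≡ : punchIn j c′ ≡ c
    c≡ = F.punchIn-punchOut j≢c
    punch≢ : ∀ {k} → k ≢ c′ → punchIn j k ≢ c
    punch≢ {k} k≢c′ eq = k≢c′ (F.punchIn-injective j k c′ (trans eq (sym c≡)))

-- The shape of the expansion of a matrix with two equal adjacent columns: only the terms that
-- delete one of them can survive, and these cancel.
Σ-adjacent : ∀ n (a : Fin n) (f : Fin (suc n) → ℤ) → f (inject₁ a) ⊕ f (fsuc a) ≡ 0ℤ →
  (∀ j → j ≢ inject₁ a → j ≢ fsuc a → f j ≡ 0ℤ) → Σ-fin (suc n) f ≡ 0ℤ
Σ-adjacent (suc n) fzero    f cancel vanish = trans
  (cong (λ z → f fzero ⊕ (f (fsuc fzero) ⊕ z)) (Σ-zero n (λ i → vanish (fsuc (fsuc i)) (λ ()) (λ ()))))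
  (trans (cong (f fzero ⊕_) (ℤₚ.+-identityʳ _)) cancel)
Σ-adjacent (suc n) (fsuc a) f cancel vanish = cong₂ _⊕_ (vanish fzero (λ ()) (λ ()))
  (Σ-adjacent n a (λ i → f (fsuc i)) cancel
    (λ j j≢a j≢a+1 → vanish (fsuc j) (λ eq → j≢a (F.suc-injective eq)) (λ eq → j≢a+1 (F.suc-injective eq))))

-- Deleting a third column leaves the two columns adjacent, so the induction in `det-adjacent` can
-- pass to minors.
punchIn-adjacent : ∀ {n} (j : Fin (suc (suc n))) (a : Fin (suc n)) → j ≢ inject₁ a → j ≢ fsuc a →
  ∃ λ (a′ : Fin n) → punchIn j (inject₁ a′) ≡ inject₁ a × punchIn j (fsuc a′) ≡ fsuc a
punchIn-adjacent fzero           fzero    j≢a j≢a+1 = contradiction refl j≢a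
punchIn-adjacent fzero           (fsuc a) j≢a j≢a+1 = a , refl , refl
punchIn-adjacent (fsuc fzero)    fzero    j≢a j≢a+1 = contradiction refl j≢a+1
punchIn-adjacent {suc n} (fsuc (fsuc j)) fzero j≢a j≢a+1 = fzero , refl , refl
punchIn-adjacent {suc n} (fsuc j) (fsuc a) j≢a j≢a+1
  with punchIn-adjacent j a (λ eq → j≢a (cong fsuc eq)) (λ eq → j≢a+1 (cong fsuc eq))
... | a′ , eq₁ , eq₂ = fsuc a′ , cong fsuc eq₁ , cong fsuc eq₂

-- The two minors differ only in which of the two equal columns is kept, and it stands in the same
-- place in both.
minor-adjacent : ∀ {n} (A : Mat (suc n)) (a : Fin n) → (∀ i → A i (inject₁ a) ≡ A i (fsuc a)) →
  minor A (inject₁ a) ≋ minor A (fsuc a)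
minor-adjacent A a eq i k = go (A (fsuc i)) a k (eq (fsuc i))
  where
  go : ∀ {n} (row : Fin (suc n) → ℤ) (a k : Fin n) → row (inject₁ a) ≡ row (fsuc a) →
    row (punchIn (inject₁ a) k) ≡ row (punchIn (fsuc a) k)
  go row fzero    fzero    eq = sym eq
  go row fzero    (fsuc k) eq = refl
  go row (fsuc a) fzero    eq = refl
  go row (fsuc a) (fsuc k) eq = go (λ k → row (fsuc k)) a k eq

det-adjacent : ∀ n (a : Fin n) → AlternatingAt (det (suc n)) (inject₁ a) (fsuc a)
det-adjacent (suc n) a A eq = Σ-adjacent (suc n) a (laplaceTerm A) cancel vanish
  where
  opp : ∀ s a d → s ⊗ (a ⊗ d) ⊕ (⊖ s) ⊗ (a ⊗ d) ≡ 0ℤ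
  opp = solve-∀
  cancel : laplaceTerm A (inject₁ a) ⊕ laplaceTerm A (fsuc a) ≡ 0ℤ
  cancel = trans
    (cong (_⊕ laplaceTerm A (fsuc a)) (cong₂ _⊗_ (cong sign (F.toℕ-inject₁ a))
      (cong₂ _⊗_ (eq fzero) (det-cong (suc n) (minor-adjacent A a eq)))))
    (opp (sign (toℕ a)) (A fzero (fsuc a)) _)
  vanish : ∀ j → j ≢ inject₁ a → j ≢ fsuc a → laplaceTerm A j ≡ 0ℤ
  vanish j j≢a j≢a+1 with punchIn-adjacent j a j≢a j≢a+1
  ... | a′ , eq₁ , eq₂ = trans
    (cong (λ z → sign (toℕ j) ⊗ (A fzero j ⊗ z)) (det-adjacent n a′ (minor A j)
      (λ i → trans (cong (A (fsuc i)) eq₁) (trans (eq (fsuc i)) (cong (A (fsuc i)) (sym eq₂))))))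
    (trans (cong (sign (toℕ j) ⊗_) (ℤₚ.*-zeroʳ (A fzero j))) (ℤₚ.*-zeroʳ (sign (toℕ j))))

inject₁≢suc : ∀ {n} (a : Fin n) → inject₁ a ≢ fsuc a
inject₁≢suc a eq = ℕₚ.m≢1+m+n (toℕ a) (trans (sym (F.toℕ-inject₁ a)) (trans (cong toℕ eq) (cong suc (sym (ℕₚ.+-identityʳ (toℕ a))))))

-- An adjacent swap moves the right one of two equal columns closer to the left one.
det-alternating-gap : ∀ {n} gap (c e : Fin n) → toℕ e ≡ suc (gap + toℕ c) → AlternatingAt (det n) c e
det-alternating-gap {suc n} zero c (fsuc e) eq A Ac≗Ae =
  det-adjacent n e A (λ i → trans (cong (A i) (sym c≡e)) (Ac≗Ae i))
  where
  c≡e : c ≡ inject₁ e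
  c≡e = F.toℕ-injective (trans (sym (ℕₚ.suc-injective eq)) (sym (F.toℕ-inject₁ e)))
det-alternating-gap {suc n} (suc gap) c (fsuc e) eq A Ac≗Ae = begin
  det (suc n) A
    ≡⟨ det-cong (suc n) restore ⟩
  det (suc n) (A [ e′ ≔ (λ i → A i e′) ] [ fsuc e ≔ (λ i → A i (fsuc e)) ])
    ≡⟨ swap-columns (det-cong (suc n)) det-linear (inject₁≢suc e) (det-adjacent n e) A _ _ ⟩
  ⊖ det (suc n) (A [ e′ ≔ (λ i → A i (fsuc e)) ] [ fsuc e ≔ (λ i → A i e′) ])
    ≡⟨ cong ⊖_ (det-alternating-gap gap c e′ toℕe′ (A [ e′ ≔ (λ i → A i (fsuc e)) ] [ fsuc e ≔ (λ i → A i e′) ]) equal) ⟩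
  0ℤ ∎
  where
  e′ : Fin (suc n)
  e′ = inject₁ e
  toℕe′ : toℕ e′ ≡ suc (gap + toℕ c)
  toℕe′ = trans (F.toℕ-inject₁ e) (ℕₚ.suc-injective eq)
  restore : A ≋ A [ e′ ≔ (λ i → A i e′) ] [ fsuc e ≔ (λ i → A i (fsuc e)) ]
  restore i k with k ≟ fsuc e
  ... | yes refl = refl
  ... | no  _ with k ≟ e′
  ...   | yes refl = refl
  ...   | no  _    = refl
  c≢e : c ≢ fsuc e
  c≢e refl = ℕₚ.m≢1+n+m (toℕ c) {suc gap} eq
  c≢e′ : c ≢ e′
  c≢e′ refl = ℕₚ.m≢1+n+m (toℕ c) {gap} toℕe′
  equal : ∀ i → (A [ e′ ≔ (λ i → A i (fsuc e)) ] [ fsuc e ≔ (λ i → A i e′) ]) i c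
              ≡ (A [ e′ ≔ (λ i → A i (fsuc e)) ] [ fsuc e ≔ (λ i → A i e′) ]) i e′
  equal i = begin
    (A [ e′ ≔ (λ i → A i (fsuc e)) ] [ fsuc e ≔ (λ i → A i e′) ]) i c
      ≡⟨ ≔-off (A [ e′ ≔ (λ i → A i (fsuc e)) ]) (fsuc e) (λ i → A i e′) i c≢e ⟩
    (A [ e′ ≔ (λ i → A i (fsuc e)) ]) i c
      ≡⟨ ≔-off A e′ _ i c≢e′ ⟩
    A i c
      ≡⟨ Ac≗Ae i ⟩
    A i (fsuc e)
      ≡⟨ sym (≔-at A e′ _ i) ⟩
    (A [ e′ ≔ (λ i → A i (fsuc e)) ]) i e′
      ≡⟨ sym (≔-off (A [ e′ ≔ (λ i → A i (fsuc e)) ]) (fsuc e) (λ i → A i e′) i (inject₁≢suc e)) ⟩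
    (A [ e′ ≔ (λ i → A i (fsuc e)) ] [ fsuc e ≔ (λ i → A i e′) ]) i e′ ∎

det-alternating : ∀ {n} {c e : Fin n} → c ≢ e → AlternatingAt (det n) c e
det-alternating {n} {c} {e} c≢e A eq with ℕₚ.<-cmp (toℕ c) (toℕ e)
... | tri< c<e _ _ = det-alternating-gap (toℕ e ∸ suc (toℕ c)) c e (sym (trans (sym (ℕₚ.+-suc _ (toℕ c))) (ℕₚ.m∸n+n≡m c<e))) A eq
... | tri≈ _ c≡e _ = contradiction (F.toℕ-injective c≡e) c≢e
... | tri> _ _ e<c = det-alternating-gap (toℕ c ∸ suc (toℕ e)) e c (sym (trans (sym (ℕₚ.+-suc _ (toℕ e))) (ℕₚ.m∸n+n≡m e<c))) A (λ i → sym (eq i))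

-- Vanishing of an alternating form, by reduction to columns that are unit vectors.

module _ {n} {h : Mat n → ℤ} (form : AlternatingForm h) (h-δ : h δ ≡ 0ℤ) where
  open AlternatingForm form

  private
    columns : (Fin n → Fin n) → Mat n
    columns τ i k = δ i (τ k)

    exchange : (Fin n → Fin n) → Fin n → Fin n → Fin n → Fin n
    exchange τ c e k with k ≟ e
    ... | yes _ = τ c
    ... | no  _ with k ≟ c
    ...   | yes _ = τ e
    ...   | no  _ = τ k

    exchange-at : ∀ τ {c e} → c ≢ e → exchange τ c e c ≡ τ e
    exchange-at τ {c} {e} c≢e with c ≟ e
    ... | yes c≡e = contradiction c≡e c≢e
    ... | no  _ with c ≟ c
    ...   | yes _   = refl
    ...   | no  c≢c = contradiction refl c≢c

    exchange-off : ∀ τ {c e k} → k ≢ c → k ≢ e → exchange τ c e k ≡ τ k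
    exchange-off τ {c} {e} {k} k≢c k≢e with k ≟ e
    ... | yes k≡e = contradiction k≡e k≢e
    ... | no  _ with k ≟ c
    ...   | yes k≡c = contradiction k≡c k≢c
    ...   | no  _   = refl

    columns-exchange : ∀ τ {c e} → c ≢ e → h (columns τ) ≡ ⊖ h (columns (exchange τ c e))
    columns-exchange τ {c} {e} c≢e = begin
      h (columns τ)
        ≡⟨ respects restore ⟩
      h (columns τ [ c ≔ (λ i → δ i (τ c)) ] [ e ≔ (λ i → δ i (τ e)) ])
        ≡⟨ swap-columns respects linear c≢e (alternating c≢e) (columns τ) _ _ ⟩
      ⊖ h (columns τ [ c ≔ (λ i → δ i (τ e)) ] [ e ≔ (λ i → δ i (τ c)) ])
        ≡⟨ cong ⊖_ (respects exchanged) ⟩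
      ⊖ h (columns (exchange τ c e)) ∎
      where
      restore : columns τ ≋ columns τ [ c ≔ (λ i → δ i (τ c)) ] [ e ≔ (λ i → δ i (τ e)) ]
      restore i k with k ≟ e
      ... | yes refl = refl
      ... | no  _ with k ≟ c
      ...   | yes refl = refl
      ...   | no  _    = refl
      exchanged : columns τ [ c ≔ (λ i → δ i (τ e)) ] [ e ≔ (λ i → δ i (τ c)) ] ≋ columns (exchange τ c e)
      exchanged i k with k ≟ e
      ... | yes refl = refl
      ... | no  _ with k ≟ c
      ...   | yes refl = refl
      ...   | no  _    = refl

    collision : ∀ τ (c : Fin n) → (∀ k → c ≢ τ k) → ∃ λ x → ∃ λ y → x ≢ y × τ x ≡ τ y
    collision = go
      where
      go : ∀ {n} (τ : Fin n → Fin n) (c : Fin n) → (∀ k → c ≢ τ k) → ∃ λ x → ∃ λ y → x ≢ y × τ x ≡ τ y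
      go {suc n} τ c c∉τ with F.pigeonhole (ℕₚ.n<1+n n) (λ k → punchOut (c∉τ k))
      ... | x , y , x<y , eq = x , y , (λ { refl → ℕₚ.<-irrefl refl x<y }) , F.punchOut-injective (c∉τ x) (c∉τ y) eq

    -- Sorting, with `s` places left. If `c`, the index `k`, is not a value of `τ`, the pigeonhole
    -- principle gives two equal columns. Otherwise `τ e ≡ c` for some `e`, and one exchange of `c`
    -- and `e` fixes `c` at the cost of a sign; places below `k` are untouched, as their values
    -- differ from `c`. At the end the matrix is `δ`.
    columns-vanish : ∀ s k → k + s ≡ n → ∀ τ → (∀ i → toℕ i < k → τ i ≡ i) → h (columns τ) ≡ 0ℤ
    columns-vanish zero k k+0≡n τ fixed =
      trans (respects (λ i j → cong (δ i) (fixed j (subst (toℕ j <_) (trans (sym k+0≡n) (ℕₚ.+-identityʳ k)) (F.toℕ<n j))))) h-δ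
    columns-vanish (suc s) k k+s≡n τ fixed with F.any? (λ i → τ i ≟ c)
      where
      k<n : k < n
      k<n = subst (suc k ≤_) (trans (sym (ℕₚ.+-suc k s)) k+s≡n) (s≤s (ℕₚ.m≤m+n k s))
      c : Fin n
      c = fromℕ< k<n
    ... | no  c∉τ with collision τ _ (λ i c≡τi → c∉τ (i , sym c≡τi))
    ...   | x , y , x≢y , τx≡τy = alternating x≢y (columns τ) (λ i → cong (δ i) τx≡τy)
    columns-vanish (suc s) k k+s≡n τ fixed | yes (e , τe≡c) with fromℕ< k<n ≟ e
      where
      k<n : k < n
      k<n = subst (suc k ≤_) (trans (sym (ℕₚ.+-suc k s)) k+s≡n) (s≤s (ℕₚ.m≤m+n k s))
    ...   | yes refl = columns-vanish s (suc k) (trans (sym (ℕₚ.+-suc k s)) k+s≡n) τ fixed′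
      where
      fixed′ : ∀ i → toℕ i < suc k → τ i ≡ i
      fixed′ i (s≤s i≤k) with ℕₚ.m≤n⇒m<n∨m≡n i≤k
      ... | inj₁ i<k = fixed i i<k
      ... | inj₂ i≡k rewrite F.toℕ-injective {i = i} {j = e} (trans i≡k (sym (F.toℕ-fromℕ< _))) = τe≡c
    ...   | no c≢e = trans (columns-exchange τ c≢e)
        (cong ⊖_ (columns-vanish s (suc k) (trans (sym (ℕₚ.+-suc k s)) k+s≡n) (exchange τ _ e) fixed′))
      where
      fixed′ : ∀ i → toℕ i < suc k → exchange τ _ e i ≡ i
      fixed′ i (s≤s i≤k) with ℕₚ.m≤n⇒m<n∨m≡n i≤k
      ... | inj₁ i<k = trans (exchange-off τ i≢c i≢e) (fixed i i<k)
        where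
        i≢c : i ≢ _
        i≢c refl = ℕₚ.<-irrefl (F.toℕ-fromℕ< _) i<k
        i≢e : i ≢ e
        i≢e refl = i≢c (trans (sym (fixed i i<k)) τe≡c)
      ... | inj₂ i≡k rewrite F.toℕ-injective {i = i} {j = fromℕ< _} (trans i≡k (sym (F.toℕ-fromℕ< _))) = trans (exchange-at τ c≢e) τe≡c

    -- Multilinear expansion, one column at a time: column `k` is written in unit vectors, `τ`
    -- records the choices made so far, and `columns-vanish` applies once all columns are unit
    -- vectors.
    prefix-vanish : ∀ s k → k + s ≡ n → ∀ A (τ : Fin n → Fin n) → (∀ c → toℕ c < k → ∀ i → A i c ≡ δ i (τ c)) → h A ≡ 0ℤ
    prefix-vanish zero k k+0≡n A τ basis = trans
      (respects (λ i j → basis j (subst (toℕ j <_) (trans (sym k+0≡n) (ℕₚ.+-identityʳ k)) (F.toℕ<n j)) i))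
      (columns-vanish n 0 refl τ (λ _ ()))
    prefix-vanish (suc s) k k+s≡n A τ basis = trans
      (respects expand)
      (≔-combination respects linear A c n (λ x → A x c) (λ x i → δ i x) (λ x →
        prefix-vanish s (suc k) (trans (sym (ℕₚ.+-suc k s)) k+s≡n) (A [ c ≔ (λ i → δ i x) ]) (τ′ x) (basis′ x)))
      where
      k<n : k < n
      k<n = subst (suc k ≤_) (trans (sym (ℕₚ.+-suc k s)) k+s≡n) (s≤s (ℕₚ.m≤m+n k s))
      c : Fin n
      c = fromℕ< k<n
      expand : A ≋ A [ c ≔ (λ i → Σ-fin n (λ x → A x c ⊗ δ i x)) ]
      expand i j with j ≟ c
      ... | yes refl = sym (trans (Σ-cong n (λ x → ℤₚ.*-comm (A x c) (δ i x))) (Σ-δˡ n i (λ x → A x c)))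
      ... | no  _    = refl
      τ′ : Fin n → Fin n → Fin n
      τ′ x j with j ≟ c
      ... | yes _ = x
      ... | no  _ = τ j
      basis′ : ∀ x j → toℕ j < suc k → ∀ i → (A [ c ≔ (λ i → δ i x) ]) i j ≡ δ i (τ′ x j)
      basis′ x j (s≤s j≤k) i with j ≟ c
      ... | yes _  = refl
      ... | no j≢c = basis j (ℕₚ.≤∧≢⇒< j≤k (λ j≡k → j≢c (F.toℕ-injective (trans j≡k (sym (F.toℕ-fromℕ< k<n)))))) i

  alternating-unique : ∀ A → h A ≡ 0ℤ
  alternating-unique A = prefix-vanish n 0 refl A (λ x → x) (λ _ ())

-- As functions of `B` both sides are alternating forms and agree at `δ`, so `alternating-unique`
-- kills their difference.
det-· : ∀ n (A B : Mat n) → det n (A · B) ≡ det n A ⊗ det n B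
det-· n A B = ℤₚ.i-j≡0⇒i≡j (det n (A · B)) (det n A ⊗ det n B) (alternating-unique form at-δ B)
  where
  h : Mat n → ℤ
  h B = det n (A · B) ⊝ det n A ⊗ det n B
  Σ-comb : ∀ s t (i : Fin n) (u v : Fin n → ℤ) →
    Σ-fin n (λ j → A i j ⊗ (s ⊗ u j ⊕ t ⊗ v j)) ≡ s ⊗ Σ-fin n (λ j → A i j ⊗ u j) ⊕ t ⊗ Σ-fin n (λ j → A i j ⊗ v j)
  Σ-comb s t i u v = trans
    (Σ-cong n (λ j → regroup (A i j) s t (u j) (v j)))
    (Σ-linear n s t (λ j → A i j ⊗ u j) (λ j → A i j ⊗ v j))
    where
    regroup : ∀ a s t u v → a ⊗ (s ⊗ u ⊕ t ⊗ v) ≡ s ⊗ (a ⊗ u) ⊕ t ⊗ (a ⊗ v)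
    regroup = solve-∀
  difference : ∀ s t x y d b c → (s ⊗ x ⊕ t ⊗ y) ⊝ d ⊗ (s ⊗ b ⊕ t ⊗ c) ≡ s ⊗ (x ⊝ d ⊗ b) ⊕ t ⊗ (y ⊝ d ⊗ c)
  difference = solve-∀
  form : AlternatingForm h
  form = record
    { respects = λ B≋C → cong₂ (λ x y → x ⊝ det n A ⊗ y)
        (det-cong n (λ i k → Σ-cong n (λ j → cong (A i j ⊗_) (B≋C j k)))) (det-cong n B≋C)
    ; linear = λ c s t {B} {C} {M} M≗B M≗C Mc → trans
        (cong₂ (λ x y → x ⊝ det n A ⊗ y)
          (det-linear c s t {A · B} {A · C} {A · M}
            (λ i k k≢c → Σ-cong n (λ j → cong (A i j ⊗_) (M≗B j k k≢c)))
            (λ i k k≢c → Σ-cong n (λ j → cong (A i j ⊗_) (M≗C j k k≢c)))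
            (λ i → trans (Σ-cong n (λ j → cong (A i j ⊗_) (Mc j))) (Σ-comb s t i (λ j → B j c) (λ j → C j c))))
          (det-linear c s t M≗B M≗C Mc))
        (difference s t (det n (A · B)) (det n (A · C)) (det n A) (det n B) (det n C))
    ; alternating = λ c≢e B eq → cong₂ (λ x y → x ⊝ y)
        (det-alternating c≢e (A · B) (λ i → Σ-cong n (λ j → cong (A i j ⊗_) (eq j))))
        (trans (cong (det n A ⊗_) (det-alternating c≢e B eq)) (ℤₚ.*-zeroʳ (det n A)))
    }
  at-δ : h δ ≡ 0ℤ
  at-δ = ℤₚ.i≡j⇒i-j≡0 {det n (A · δ)} {det n A ⊗ det n δ} (trans
    (det-cong n (λ i k → Σ-δʳ n k (A i)))
    (sym (trans (cong (det n A ⊗_) (det-δ n)) (ℤₚ.*-identityʳ (det n A)))))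

-- Determinants of block triangular matrices.

punchIn-↑ˡ : ∀ {r} d (j : Fin (suc r)) (k : Fin r) → punchIn (j ↑ˡ d) (k ↑ˡ d) ≡ punchIn j k ↑ˡ d
punchIn-↑ˡ d fzero    k        = refl
punchIn-↑ˡ d (fsuc j) fzero    = refl
punchIn-↑ˡ d (fsuc j) (fsuc k) = cong fsuc (punchIn-↑ˡ d j k)

punchIn-↑ʳ : ∀ {r} d (j : Fin (suc r)) (k : Fin d) → punchIn (j ↑ˡ d) (r ↑ʳ k) ≡ suc r ↑ʳ k
punchIn-↑ʳ         d fzero    k = refl
punchIn-↑ʳ {suc r} d (fsuc j) k = cong fsuc (punchIn-↑ʳ d j k)

-- Expand along the first row: terms from the last `d` columns have zero entry, and the minors of
-- the other terms are again block triangular with the same lower right block.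
det-block : ∀ r d (T : Mat (r + d)) → (∀ i j → T (i ↑ˡ d) (r ↑ʳ j) ≡ 0ℤ) →
  det (r + d) T ≡ det r (λ i k → T (i ↑ˡ d) (k ↑ˡ d)) ⊗ det d (λ i k → T (r ↑ʳ i) (r ↑ʳ k))
det-block zero    d T upper = sym (ℤₚ.*-identityˡ _)
det-block (suc r) d T upper = begin
  Σ-fin (suc r + d) (laplaceTerm T)
    ≡⟨ Σ-split (suc r) d (laplaceTerm T) ⟩
  Σ-fin (suc r) (λ j → laplaceTerm T (j ↑ˡ d)) ⊕ Σ-fin d (λ j → laplaceTerm T (suc r ↑ʳ j))
    ≡⟨ cong₂ _⊕_ (Σ-cong (suc r) left) (Σ-zero d right) ⟩
  Σ-fin (suc r) (λ j → laplaceTerm C j ⊗ det d D) ⊕ 0ℤ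
    ≡⟨ ℤₚ.+-identityʳ (Σ-fin (suc r) (λ j → laplaceTerm C j ⊗ det d D)) ⟩
  Σ-fin (suc r) (λ j → laplaceTerm C j ⊗ det d D)
    ≡⟨ Σ-*ʳ (suc r) (det d D) (laplaceTerm C) ⟩
  det (suc r) C ⊗ det d D ∎
  where
  C : Mat (suc r)
  C i k = T (i ↑ˡ d) (k ↑ˡ d)
  D : Mat d
  D i k = T (suc r ↑ʳ i) (suc r ↑ʳ k)
  regroup : ∀ s t x y → s ⊗ (t ⊗ (x ⊗ y)) ≡ (s ⊗ (t ⊗ x)) ⊗ y
  regroup = solve-∀
  left : ∀ j → laplaceTerm T (j ↑ˡ d) ≡ laplaceTerm C j ⊗ det d D
  left j = begin
    sign (toℕ (j ↑ˡ d)) ⊗ (C fzero j ⊗ det (r + d) (minor T (j ↑ˡ d)))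
      ≡⟨ cong₂ (λ s z → sign s ⊗ (C fzero j ⊗ z)) (F.toℕ-↑ˡ j d)
           (det-block r d (minor T (j ↑ˡ d)) (λ i k → trans (cong (T (fsuc (i ↑ˡ d))) (punchIn-↑ʳ d j k)) (upper (fsuc i) k))) ⟩
    sign (toℕ j) ⊗ (C fzero j ⊗ (det r (λ i k → minor T (j ↑ˡ d) (i ↑ˡ d) (k ↑ˡ d)) ⊗ det d (λ i k → minor T (j ↑ˡ d) (r ↑ʳ i) (r ↑ʳ k))))
      ≡⟨ cong₂ (λ x y → sign (toℕ j) ⊗ (C fzero j ⊗ (x ⊗ y)))
           (det-cong r (λ i k → cong (T (fsuc (i ↑ˡ d))) (punchIn-↑ˡ d j k)))
           (det-cong d (λ i k → cong (T (fsuc (r ↑ʳ i))) (punchIn-↑ʳ d j k))) ⟩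
    sign (toℕ j) ⊗ (C fzero j ⊗ (det r (minor C j) ⊗ det d D))
      ≡⟨ regroup (sign (toℕ j)) (C fzero j) (det r (minor C j)) (det d D) ⟩
    laplaceTerm C j ⊗ det d D ∎
  right : ∀ j → laplaceTerm T (suc r ↑ʳ j) ≡ 0ℤ
  right j = trans
    (cong (λ z → sign (toℕ (suc r ↑ʳ j)) ⊗ (z ⊗ det (r + d) (minor T (suc r ↑ʳ j)))) (upper fzero j))
    (ℤₚ.*-zeroʳ (sign (toℕ (suc r ↑ʳ j))))

-- Circulant matrices as polynomials in the cyclic shift

next : ∀ {n} → Fin n → Fin n
next {suc m} i = suc (toℕ i) mod suc m

toℕ-mod : ∀ a m → toℕ (a mod suc m) ≡ a % suc m
toℕ-mod a m = F.toℕ-fromℕ< (DM.m%n<n a (suc m))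

mod-cong : ∀ m a b → a % suc m ≡ b % suc m → a mod suc m ≡ b mod suc m
mod-cong m a b eq = F.toℕ-injective (trans (toℕ-mod a m) (trans eq (sym (toℕ-mod b m))))

[a%n+b]%n : ∀ a b n .{{_ : ℕ.NonZero n}} → (a % n + b) % n ≡ (a + b) % n
[a%n+b]%n a b n = begin
  (a % n + b) % n             ≡⟨ DM.%-distribˡ-+ (a % n) b n ⟩
  (a % n % n + b % n) % n     ≡⟨ cong (λ z → (z + b % n) % n) (DM.m%n%n≡m%n a n) ⟩
  (a % n + b % n) % n         ≡⟨ DM.%-distribˡ-+ a b n ⟨
  (a + b) % n                 ∎

next^ : ∀ {n} → ℕ → Fin n → Fin n
next^ zero    i = i
next^ (suc s) i = next^ s (next i)

toℕ-next^ : ∀ {n} .{{_ : ℕ.NonZero n}} s (i : Fin n) → toℕ (next^ s i) ≡ (toℕ i + s) % n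
toℕ-next^ {suc m} zero    i = sym (trans (cong (_% suc m) (ℕₚ.+-identityʳ (toℕ i))) (DM.m<n⇒m%n≡m (F.toℕ<n i)))
toℕ-next^ {suc m} (suc s) i = begin
  toℕ (next^ s (next i))              ≡⟨ toℕ-next^ s (next i) ⟩
  (toℕ (next i) + s) % suc m          ≡⟨ cong (λ z → (z + s) % suc m) (toℕ-mod (suc (toℕ i)) m) ⟩
  (suc (toℕ i) % suc m + s) % suc m   ≡⟨ [a%n+b]%n (suc (toℕ i)) s (suc m) ⟩
  (suc (toℕ i) + s) % suc m           ≡⟨ cong (_% suc m) (sym (ℕₚ.+-suc (toℕ i) s)) ⟩
  (toℕ i + suc s) % suc m             ∎

next^-period : ∀ {n} s (i : Fin n) → n ∣ s → next^ s i ≡ i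
next^-period {suc m} s i n∣s = F.toℕ-injective (trans (toℕ-next^ s i)
  (trans (DM.%-remove-+ʳ (toℕ i) n∣s) (DM.m<n⇒m%n≡m (F.toℕ<n i))))

next^-+ : ∀ {n} s t (i : Fin n) → next^ (s + t) i ≡ next^ t (next^ s i)
next^-+ zero    t i = refl
next^-+ (suc s) t i = next^-+ s t (next i)

-- A list of coefficients, constant term first, read in ℤ[x]/(xⁿ - 1); next is the action of x on
-- row indices.

Poly : Set
Poly = List ℤ

ev : ∀ n → Poly → Mat n
ev n []      i k = 0ℤ
ev n (c ∷ F) i k = c ⊗ δ i k ⊕ ev n F (next i) k

infix 4 _≈[_]_
_≈[_]_ : Poly → ℕ → Poly → Set
F ≈[ n ] G = ev n F ≋ ev n G

infixl 6 _⊞_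
_⊞_ : Poly → Poly → Poly
[]      ⊞ G       = G
(a ∷ F) ⊞ []      = a ∷ F
(a ∷ F) ⊞ (b ∷ G) = (a ⊕ b) ∷ (F ⊞ G)

infixr 7 _◂_
_◂_ : ℤ → Poly → Poly
c ◂ []      = []
c ◂ (a ∷ F) = (c ⊗ a) ∷ (c ◂ F)

shift : ℕ → Poly → Poly
shift zero    F = F
shift (suc s) F = 0ℤ ∷ shift s F

infixl 7 _⊡_
_⊡_ : Poly → Poly → Poly
[]      ⊡ G = []
(a ∷ F) ⊡ G = (a ◂ G) ⊞ (0ℤ ∷ (F ⊡ G))

one : Poly
one = 1ℤ ∷ []

module _ {n : ℕ} where

  ev-⊞ : ∀ F G (i k : Fin n) → ev n (F ⊞ G) i k ≡ ev n F i k ⊕ ev n G i k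
  ev-⊞ []      G       i k = sym (ℤₚ.+-identityˡ (ev n G i k))
  ev-⊞ (a ∷ F) []      i k = sym (ℤₚ.+-identityʳ (ev n (a ∷ F) i k))
  ev-⊞ (a ∷ F) (b ∷ G) i k = trans
    (cong ((a ⊕ b) ⊗ δ i k ⊕_) (ev-⊞ F G (next i) k))
    (regroup a b (δ i k) (ev n F (next i) k) (ev n G (next i) k))
    where
    regroup : ∀ a b e x y → (a ⊕ b) ⊗ e ⊕ (x ⊕ y) ≡ (a ⊗ e ⊕ x) ⊕ (b ⊗ e ⊕ y)
    regroup = solve-∀

  ev-◂ : ∀ c F (i k : Fin n) → ev n (c ◂ F) i k ≡ c ⊗ ev n F i k
  ev-◂ c []      i k = sym (ℤₚ.*-zeroʳ c)
  ev-◂ c (a ∷ F) i k = trans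
    (cong ((c ⊗ a) ⊗ δ i k ⊕_) (ev-◂ c F (next i) k))
    (regroup c a (δ i k) (ev n F (next i) k))
    where
    regroup : ∀ c a e x → (c ⊗ a) ⊗ e ⊕ c ⊗ x ≡ c ⊗ (a ⊗ e ⊕ x)
    regroup = solve-∀

  ev-shift : ∀ s F (i k : Fin n) → ev n (shift s F) i k ≡ ev n F (next^ s i) k
  ev-shift zero    F i k = refl
  ev-shift (suc s) F i k = trans (ℤₚ.+-identityˡ (ev n (shift s F) (next i) k)) (ev-shift s F (next i) k)

  ev-one : ∀ (i k : Fin n) → ev n one i k ≡ δ i k
  ev-one i k = trans (ℤₚ.+-identityʳ (1ℤ ⊗ δ i k)) (ℤₚ.*-identityˡ (δ i k))

  ev-⊡ : ∀ F G → ev n (F ⊡ G) ≋ ev n F · ev n G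
  ev-⊡ []      G i k = sym (Σ-zero n (λ _ → refl))
  ev-⊡ (a ∷ F) G i k = begin
    ev n ((a ◂ G) ⊞ (0ℤ ∷ (F ⊡ G))) i k
      ≡⟨ ev-⊞ (a ◂ G) (0ℤ ∷ (F ⊡ G)) i k ⟩
    ev n (a ◂ G) i k ⊕ ev n (shift 1 (F ⊡ G)) i k
      ≡⟨ cong₂ _⊕_ (ev-◂ a G i k) (trans (ev-shift 1 (F ⊡ G) i k) (ev-⊡ F G (next i) k)) ⟩
    a ⊗ ev n G i k ⊕ (ev n F · ev n G) (next i) k
      ≡⟨ cong (λ z → a ⊗ z ⊕ (ev n F · ev n G) (next i) k) (sym (Σ-δˡ n i (λ j → ev n G j k))) ⟩
    a ⊗ Σ-fin n (λ j → δ i j ⊗ ev n G j k) ⊕ (ev n F · ev n G) (next i) k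
      ≡⟨ cong (_⊕ (ev n F · ev n G) (next i) k) (sym (Σ-*ˡ n a (λ j → δ i j ⊗ ev n G j k))) ⟩
    Σ-fin n (λ j → a ⊗ (δ i j ⊗ ev n G j k)) ⊕ (ev n F · ev n G) (next i) k
      ≡⟨ sym (Σ-+ n (λ j → a ⊗ (δ i j ⊗ ev n G j k)) (λ j → ev n F (next i) j ⊗ ev n G j k)) ⟩
    Σ-fin n (λ j → a ⊗ (δ i j ⊗ ev n G j k) ⊕ ev n F (next i) j ⊗ ev n G j k)
      ≡⟨ Σ-cong n (λ j → regroup a (δ i j) (ev n F (next i) j) (ev n G j k)) ⟩
    (ev n (a ∷ F) · ev n G) i k ∎
    where
    regroup : ∀ a e x y → a ⊗ (e ⊗ y) ⊕ x ⊗ y ≡ (a ⊗ e ⊕ x) ⊗ y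
    regroup = solve-∀

-- Moving down one row lowers the index `k - i` by one, which modulo `suc m` means adding `m`. The
-- last row, where `next` wraps to zero, is the second case of `last`.
circulant-next : ∀ m (i : Fin (suc m)) (k : Fin (suc m)) →
  (toℕ k + (suc m ∸ toℕ (next i))) mod suc m ≡ (toℕ ((toℕ k + (suc m ∸ toℕ i)) mod suc m) + m) mod suc m
circulant-next m i k = mod-cong m
  (toℕ k + (suc m ∸ toℕ (next i))) (toℕ ((toℕ k + (suc m ∸ toℕ i)) mod suc m) + m) (trans (cong (λ z → (toℕ k + (suc m ∸ z)) % suc m) (toℕ-mod (suc (toℕ i)) m))
  (sym (trans (cong (λ z → (z + m) % suc m) (toℕ-mod (toℕ k + (suc m ∸ toℕ i)) m))
    (trans ([a%n+b]%n (toℕ k + (suc m ∸ toℕ i)) m (suc m)) (last (ℕₚ.m≤n⇒m<n∨m≡n (F.toℕ<n i)))))))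
  where
  last : suc (toℕ i) < suc m ⊎ suc (toℕ i) ≡ suc m →
    (toℕ k + (suc m ∸ toℕ i) + m) % suc m ≡ (toℕ k + (suc m ∸ suc (toℕ i) % suc m)) % suc m
  last (inj₁ (s≤s i<m)) = begin
    (toℕ k + (suc m ∸ toℕ i) + m) % suc m
      ≡⟨ cong (λ z → (toℕ k + z + m) % suc m) (ℕₚ.+-∸-assoc 1 (ℕₚ.<⇒≤ i<m)) ⟩
    (toℕ k + suc (m ∸ toℕ i) + m) % suc m
      ≡⟨ cong (_% suc m) (trans (cong (_+ m) (ℕₚ.+-suc (toℕ k) (m ∸ toℕ i))) (sym (ℕₚ.+-suc (toℕ k + (m ∸ toℕ i)) m))) ⟩
    (toℕ k + (m ∸ toℕ i) + suc m) % suc m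
      ≡⟨ DM.[m+n]%n≡m%n (toℕ k + (m ∸ toℕ i)) (suc m) ⟩
    (toℕ k + (m ∸ toℕ i)) % suc m
      ≡⟨ cong (λ z → (toℕ k + (suc m ∸ z)) % suc m) (sym (DM.m<n⇒m%n≡m (s≤s i<m))) ⟩
    (toℕ k + (suc m ∸ suc (toℕ i) % suc m)) % suc m ∎
  last (inj₂ eq) = begin
    (toℕ k + (suc m ∸ toℕ i) + m) % suc m
      ≡⟨ cong (λ z → (toℕ k + (suc m ∸ z) + m) % suc m) (ℕₚ.suc-injective eq) ⟩
    (toℕ k + (suc m ∸ m) + m) % suc m
      ≡⟨ cong (_% suc m) (trans (ℕₚ.+-assoc (toℕ k) (suc m ∸ m) m) (cong (λ z → toℕ k + z) (ℕₚ.m∸n+n≡m (ℕₚ.n≤1+n m)))) ⟩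
    (toℕ k + suc m) % suc m
      ≡⟨ cong (λ z → (toℕ k + (suc m ∸ z)) % suc m) (sym (trans (cong (_% suc m) eq) (DM.n%n≡0 (suc m)))) ⟩
    (toℕ k + (suc m ∸ suc (toℕ i) % suc m)) % suc m ∎

-- Both indices lie below `suc m`, so the residue of `k - i` is zero only on the diagonal. This is
-- the circulant form of the identity matrix.
circulant-δ : ∀ m (i k : Fin (suc m)) → δ i k ≡ δ fzero ((toℕ k + (suc m ∸ toℕ i)) mod suc m)
circulant-δ m i k = case (ℕₚ.<-cmp (toℕ k) (toℕ i))
  where
  t = toℕ k + (suc m ∸ toℕ i)
  i≤n : toℕ i ≤ suc m
  i≤n = ℕₚ.<⇒≤ (F.toℕ<n i)
  nonzero : i ≢ k → t % suc m ≢ 0 → δ i k ≡ δ fzero (t mod suc m)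
  nonzero i≢k t≢0 = trans (δ-≢ i≢k)
    (sym (δ-≢ {i = fzero} {j = t mod suc m} (λ eq → t≢0 (trans (sym (toℕ-mod t m)) (sym (cong toℕ eq))))))
  case : Tri (toℕ k < toℕ i) (toℕ k ≡ toℕ i) (toℕ i < toℕ k) → δ i k ≡ δ fzero (t mod suc m)
  case (tri≈ _ k≡i _) = begin
    δ i k                       ≡⟨ cong (δ i) (F.toℕ-injective k≡i) ⟩
    δ i i                       ≡⟨ δ-refl i ⟩
    δ (fzero {m}) fzero         ≡⟨ cong (δ fzero) (F.toℕ-injective (sym (trans (toℕ-mod t m) t%n≡0))) ⟩
    δ fzero (t mod suc m)       ∎
    where
    t%n≡0 : t % suc m ≡ 0
    t%n≡0 = trans (cong (_% suc m) (trans (cong (_+ (suc m ∸ toℕ i)) k≡i) (ℕₚ.m+[n∸m]≡n i≤n))) (DM.n%n≡0 (suc m))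
  case (tri< k<i k≢i _) = nonzero (λ i≡k → k≢i (cong toℕ (sym i≡k)))
    (λ t≡0 → ℕₚ.<⇒≢ positive (trans (sym t≡0) (DM.m<n⇒m%n≡m below)))
    where
    below : t < suc m
    below = subst (t <_) (ℕₚ.m+[n∸m]≡n i≤n) (ℕₚ.+-monoˡ-< (suc m ∸ toℕ i) k<i)
    positive : 0 < t
    positive = ℕₚ.<-≤-trans (ℕₚ.m<n⇒0<n∸m (F.toℕ<n i)) (ℕₚ.m≤n+m _ (toℕ k))
  case (tri> _ k≢i i<k) = nonzero (λ i≡k → k≢i (cong toℕ (sym i≡k)))
    (λ t≡0 → ℕₚ.<⇒≢ (ℕₚ.m<n⇒0<n∸m i<k) (trans (sym t≡0) wrap))
    where
    wrap : t % suc m ≡ toℕ k ∸ toℕ i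
    wrap = begin
      (toℕ k + (suc m ∸ toℕ i)) % suc m
        ≡⟨ cong (_% suc m) (trans (sym (ℕₚ.+-∸-assoc (toℕ k) i≤n)) (ℕₚ.+-∸-comm (suc m) (ℕₚ.<⇒≤ i<k))) ⟩
      (toℕ k ∸ toℕ i + suc m) % suc m
        ≡⟨ DM.[m+n]%n≡m%n (toℕ k ∸ toℕ i) (suc m) ⟩
      (toℕ k ∸ toℕ i) % suc m
        ≡⟨ DM.m<n⇒m%n≡m (ℕₚ.≤-<-trans (ℕₚ.m∸n≤m (toℕ k) (toℕ i)) (F.toℕ<n k)) ⟩
      toℕ k ∸ toℕ i ∎

ev-circulant : ∀ n F → ∃ λ a → ev n F ≋ circulant n a
ev-circulant zero    F       = (λ ()) , (λ ())
ev-circulant (suc m) []      = (λ _ → 0ℤ) , (λ _ _ → refl)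
ev-circulant (suc m) (c ∷ F) with ev-circulant (suc m) F
-- Multiplication by x moves the coefficient at `t - 1` to `t`; `t - 1` is written as `t + m` modulo
-- `suc m`.
... | a , F≋a = (λ t → c ⊗ δ fzero t ⊕ a ((toℕ t + m) mod suc m)) , (λ i k →
  cong₂ _⊕_ (cong (c ⊗_) (circulant-δ m i k)) (trans (F≋a (next i) k) (cong a (circulant-next m i k))))

det-ev∈S : ∀ n F → InS n (det n (ev n F))
det-ev∈S n F with ev-circulant n F
... | a , F≋a = a , sym (det-cong n F≋a)

-- Block matrices.

δ-↑ˡ : ∀ {r} d (i k : Fin r) → δ (i ↑ˡ d) (k ↑ˡ d) ≡ δ i k
δ-↑ˡ d fzero    fzero    = refl
δ-↑ˡ d fzero    (fsuc k) = refl
δ-↑ˡ d (fsuc i) fzero    = refl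
δ-↑ˡ d (fsuc i) (fsuc k) = δ-↑ˡ d i k

δ-↑ʳ : ∀ r {d} (i k : Fin d) → δ (r ↑ʳ i) (r ↑ʳ k) ≡ δ i k
δ-↑ʳ zero    i k = refl
δ-↑ʳ (suc r) i k = δ-↑ʳ r i k

δ-↑ʳ-↑ˡ : ∀ {r d} (i : Fin d) (k : Fin r) → δ (r ↑ʳ i) (k ↑ˡ d) ≡ 0ℤ
δ-↑ʳ-↑ˡ i fzero    = refl
δ-↑ʳ-↑ˡ i (fsuc k) = δ-↑ʳ-↑ˡ i k

δ-↑ˡ-↑ʳ : ∀ {r d} (i : Fin r) (k : Fin d) → δ (i ↑ˡ d) (r ↑ʳ k) ≡ 0ℤ
δ-↑ˡ-↑ʳ i k = trans (δ-sym (i ↑ˡ _) (_ ↑ʳ k)) (δ-↑ʳ-↑ˡ k i)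

by-halves : ∀ {ℓ} r d {P : Fin (r + d) → Set ℓ} → (∀ i → P (i ↑ˡ d)) → (∀ j → P (r ↑ʳ j)) → ∀ i → P i
by-halves r d {P} left right i with splitAt r i in eq
... | inj₁ i′ = subst P (F.splitAt⁻¹-↑ˡ eq) (left i′)
... | inj₂ j′ = subst P (F.splitAt⁻¹-↑ʳ eq) (right j′)

blocks : ∀ r d → Mat r → (Fin r → Fin d → ℤ) → (Fin d → Fin r → ℤ) → Mat d → Mat (r + d)
blocks r d A B C D i k with splitAt r i | splitAt r k
... | inj₁ i′ | inj₁ k′ = A i′ k′
... | inj₁ i′ | inj₂ k′ = B i′ k′
... | inj₂ i′ | inj₁ k′ = C i′ k′
... | inj₂ i′ | inj₂ k′ = D i′ k′

module _ {r d} (A : Mat r) (B : Fin r → Fin d → ℤ) (C : Fin d → Fin r → ℤ) (D : Mat d) where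

  blocks₁₁ : ∀ i k → blocks r d A B C D (i ↑ˡ d) (k ↑ˡ d) ≡ A i k
  blocks₁₁ i k rewrite F.splitAt-↑ˡ r i d | F.splitAt-↑ˡ r k d = refl

  blocks₁₂ : ∀ i k → blocks r d A B C D (i ↑ˡ d) (r ↑ʳ k) ≡ B i k
  blocks₁₂ i k rewrite F.splitAt-↑ˡ r i d | F.splitAt-↑ʳ r d k = refl

  blocks₂₁ : ∀ i k → blocks r d A B C D (r ↑ʳ i) (k ↑ˡ d) ≡ C i k
  blocks₂₁ i k rewrite F.splitAt-↑ʳ r d i | F.splitAt-↑ˡ r k d = refl

  blocks₂₂ : ∀ i k → blocks r d A B C D (r ↑ʳ i) (r ↑ʳ k) ≡ D i k
  blocks₂₂ i k rewrite F.splitAt-↑ʳ r d i | F.splitAt-↑ʳ r d k = refl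

-- Relative norms for a divisor of n.

-- For d ∣ n = r + d the vectors of ℤⁿ of period d form an invariant sublattice, on which F acts
-- as its image in ℤ[x]/(x^d - 1).  Completing the obvious basis of that sublattice by the first r
-- unit vectors makes ev n F block triangular, with the action on the quotient lattice as its
-- other diagonal block.

module Quotient (r d-1 : ℕ) (d∣r : suc d-1 ∣ r) where

  d n : ℕ
  d = suc d-1
  n = r + d

  instance
    n≢0 : ℕ.NonZero n
    n≢0 = ℕ.>-nonZero (ℕₚ.<-≤-trans ℕ.z<s (ℕₚ.m≤n+m d r))

  π : Fin n → Fin d
  π i = toℕ i mod d

  π-next : ∀ i → π (next i) ≡ next (π i)
  π-next i = F.toℕ-injective (begin
    toℕ (π (next i))             ≡⟨ toℕ-mod (toℕ (next i)) d-1 ⟩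
    toℕ (next i) % d             ≡⟨ cong (_% d) (toℕ-next^ 1 i) ⟩
    (toℕ i + 1) % n % d          ≡⟨ DM.m∣n⇒o%n%m≡o%m d n (toℕ i + 1) (Dv.∣m∣n⇒∣m+n d∣r Dv.∣-refl) ⟩
    (toℕ i + 1) % d              ≡⟨ [a%n+b]%n (toℕ i) 1 d ⟨
    (toℕ i % d + 1) % d          ≡⟨ cong (λ z → (z + 1) % d) (toℕ-mod (toℕ i) d-1) ⟨
    (toℕ (π i) + 1) % d          ≡⟨ toℕ-next^ 1 (π i) ⟨
    toℕ (next (π i))             ∎)

  π-↑ʳ : ∀ j → π (r ↑ʳ j) ≡ j
  π-↑ʳ j = F.toℕ-injective (begin
    toℕ (π (r ↑ʳ j))     ≡⟨ toℕ-mod (toℕ (r ↑ʳ j)) d-1 ⟩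
    toℕ (r ↑ʳ j) % d     ≡⟨ cong (_% d) (F.toℕ-↑ʳ r j) ⟩
    (r + toℕ j) % d      ≡⟨ DM.%-remove-+ˡ (toℕ j) d∣r ⟩
    toℕ j % d            ≡⟨ DM.m<n⇒m%n≡m (F.toℕ<n j) ⟩
    toℕ j                ∎)

  -- The representative, among the last `d` indices, of the class of `i` modulo `d`.
  ρ : Fin r → Fin n
  ρ i = r ↑ʳ π (i ↑ˡ d)

  -- The vectors `λ k → δ (π k) j` form the obvious basis of the vectors of period `d`. Since `π`
  -- commutes with `next`, `F` acts on them as on ℤ[x]/(x^d - 1).
  ev-periodic : ∀ F i j → Σ-fin n (λ k → ev n F i k ⊗ δ (π k) j) ≡ ev d F (π i) j
  ev-periodic []      i j = Σ-zero n (λ _ → refl)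
  ev-periodic (c ∷ F) i j = begin
    Σ-fin n (λ k → (c ⊗ δ i k ⊕ ev n F (next i) k) ⊗ δ (π k) j)
      ≡⟨ Σ-cong n (λ k → regroup c (δ i k) (ev n F (next i) k) (δ (π k) j)) ⟩
    Σ-fin n (λ k → c ⊗ (δ i k ⊗ δ (π k) j) ⊕ ev n F (next i) k ⊗ δ (π k) j)
      ≡⟨ Σ-+ n (λ k → c ⊗ (δ i k ⊗ δ (π k) j)) (λ k → ev n F (next i) k ⊗ δ (π k) j) ⟩
    Σ-fin n (λ k → c ⊗ (δ i k ⊗ δ (π k) j)) ⊕ Σ-fin n (λ k → ev n F (next i) k ⊗ δ (π k) j)
      ≡⟨ cong₂ _⊕_ (trans (Σ-*ˡ n c (λ k → δ i k ⊗ δ (π k) j)) (cong (c ⊗_) (Σ-δˡ n i (λ k → δ (π k) j))))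
           (trans (ev-periodic F (next i) j) (cong (λ z → ev d F z j) (π-next i))) ⟩
    c ⊗ δ (π i) j ⊕ ev d F (next (π i)) j ∎
    where
    regroup : ∀ c e x y → (c ⊗ e ⊕ x) ⊗ y ≡ c ⊗ (e ⊗ y) ⊕ x ⊗ y
    regroup = solve-∀

  ev-periodic-split : ∀ F i j →
    Σ-fin r (λ k → ev n F i (k ↑ˡ d) ⊗ δ (π (k ↑ˡ d)) j) ⊕ ev n F i (r ↑ʳ j) ≡ ev d F (π i) j
  ev-periodic-split F i j = begin
    Σ-fin r (λ k → ev n F i (k ↑ˡ d) ⊗ δ (π (k ↑ˡ d)) j) ⊕ ev n F i (r ↑ʳ j)
      ≡⟨ cong (Σ-fin r (λ k → ev n F i (k ↑ˡ d) ⊗ δ (π (k ↑ˡ d)) j) ⊕_) (sym (trans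
           (Σ-cong d (λ l → cong (λ z → ev n F i (r ↑ʳ l) ⊗ δ z j) (π-↑ʳ l)))
           (Σ-δʳ d j (λ l → ev n F i (r ↑ʳ l))))) ⟩
    Σ-fin r (λ k → ev n F i (k ↑ˡ d) ⊗ δ (π (k ↑ˡ d)) j) ⊕ Σ-fin d (λ l → ev n F i (r ↑ʳ l) ⊗ δ (π (r ↑ʳ l)) j)
      ≡⟨ Σ-split r d (λ k → ev n F i k ⊗ δ (π k) j) ⟨
    Σ-fin n (λ k → ev n F i k ⊗ δ (π k) j)
      ≡⟨ ev-periodic F i j ⟩
    ev d F (π i) j ∎

  -- Each class modulo periodic vectors has a unique representative vanishing at the last `d`
  -- places. Passing to it subtracts from the entry at `i` the entry at `ρ i`, which gives this
  -- matrix of the quotient action.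
  quot : Poly → Mat r
  quot F i k = ev n F (i ↑ˡ d) (k ↑ˡ d) ⊝ ev n F (ρ i) (k ↑ˡ d)

  relNorm : Poly → ℤ
  relNorm F = det r (quot F)

  private
    E : Fin r → Fin d → ℤ
    E i j = δ (π (i ↑ˡ d)) j

    -- The change of basis: the columns of `K` are the first `r` unit vectors followed by the `d`
    -- periodic basis vectors.
    K K⁻¹ : Mat n
    K   = blocks r d δ E (λ _ _ → 0ℤ) δ
    K⁻¹ = blocks r d δ (λ i j → ⊖ E i j) (λ _ _ → 0ℤ) δ

    T : Poly → Mat n
    T F = blocks r d (quot F) (λ _ _ → 0ℤ) (λ i k → ev n F (r ↑ʳ i) (k ↑ˡ d)) (ev d F)

    Σ-halves : ∀ (f : Fin n → ℤ) {x y} → Σ-fin r (λ k → f (k ↑ˡ d)) ≡ x → Σ-fin d (λ l → f (r ↑ʳ l)) ≡ y →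
      Σ-fin n f ≡ x ⊕ y
    Σ-halves f eq₁ eq₂ = trans (Σ-split r d f) (cong₂ _⊕_ eq₁ eq₂)

    Σ-zeroˡ : ∀ m (f g : Fin m → ℤ) → (∀ k → f k ≡ 0ℤ) → Σ-fin m (λ k → f k ⊗ g k) ≡ 0ℤ
    Σ-zeroˡ m f g f≗0 = Σ-zero m (λ k → cong (_⊗ g k) (f≗0 k))

    Σ-zeroʳ : ∀ m (f g : Fin m → ℤ) → (∀ k → g k ≡ 0ℤ) → Σ-fin m (λ k → f k ⊗ g k) ≡ 0ℤ
    Σ-zeroʳ m f g g≗0 = Σ-zero m (λ k → trans (cong (f k ⊗_) (g≗0 k)) (ℤₚ.*-zeroʳ (f k)))

    Σ-unitˡ : ∀ m (f g : Fin m → ℤ) i → (∀ k → f k ≡ δ i k) → Σ-fin m (λ k → f k ⊗ g k) ≡ g i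
    Σ-unitˡ m f g i f≗δ = trans (Σ-cong m (λ k → cong (_⊗ g k) (f≗δ k))) (Σ-δˡ m i g)

    Σ-unitʳ : ∀ m (f g : Fin m → ℤ) i → (∀ k → g k ≡ δ k i) → Σ-fin m (λ k → f k ⊗ g k) ≡ f i
    Σ-unitʳ m f g i g≗δ = trans (Σ-cong m (λ k → cong (f k ⊗_) (g≗δ k))) (Σ-δʳ m i f)

    K₁₁ = blocks₁₁ {r} {d} δ E (λ _ _ → 0ℤ) δ
    K₁₂ = blocks₁₂ {r} {d} δ E (λ _ _ → 0ℤ) δ
    K₂₁ = blocks₂₁ {r} {d} δ E (λ _ _ → 0ℤ) δ
    K₂₂ = blocks₂₂ {r} {d} δ E (λ _ _ → 0ℤ) δ

    K·-top : ∀ (M : Mat n) i k → (K · M) (i ↑ˡ d) k ≡ M (i ↑ˡ d) k ⊕ M (ρ i) k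
    K·-top M i k = Σ-halves (λ j → K (i ↑ˡ d) j ⊗ M j k)
      (Σ-unitˡ r (λ j → K (i ↑ˡ d) (j ↑ˡ d)) (λ j → M (j ↑ˡ d) k) i (K₁₁ i))
      (Σ-unitˡ d (λ j → K (i ↑ˡ d) (r ↑ʳ j)) (λ j → M (r ↑ʳ j) k) (π (i ↑ˡ d)) (K₁₂ i))

    K·-bottom : ∀ (M : Mat n) i k → (K · M) (r ↑ʳ i) k ≡ M (r ↑ʳ i) k
    K·-bottom M i k = trans (Σ-halves (λ j → K (r ↑ʳ i) j ⊗ M j k)
      (Σ-zeroˡ r (λ j → K (r ↑ʳ i) (j ↑ˡ d)) (λ j → M (j ↑ˡ d) k) (K₂₁ i))
      (Σ-unitˡ d (λ j → K (r ↑ʳ i) (r ↑ʳ j)) (λ j → M (r ↑ʳ j) k) i (K₂₂ i)))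
      (ℤₚ.+-identityˡ (M (r ↑ʳ i) k))

    ·K-left : ∀ (M : Mat n) i k → (M · K) i (k ↑ˡ d) ≡ M i (k ↑ˡ d)
    ·K-left M i k = trans (Σ-halves (λ j → M i j ⊗ K j (k ↑ˡ d))
      (Σ-unitʳ r (λ j → M i (j ↑ˡ d)) (λ j → K (j ↑ˡ d) (k ↑ˡ d)) k (λ j → K₁₁ j k))
      (Σ-zeroʳ d (λ j → M i (r ↑ʳ j)) (λ j → K (r ↑ʳ j) (k ↑ˡ d)) (λ j → K₂₁ j k)))
      (ℤₚ.+-identityʳ (M i (k ↑ˡ d)))

    ·K-right : ∀ F i j → (ev n F · K) i (r ↑ʳ j) ≡ ev d F (π i) j
    ·K-right F i j = trans (Σ-halves (λ k → ev n F i k ⊗ K k (r ↑ʳ j))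
      (Σ-cong r (λ k → cong (ev n F i (k ↑ˡ d) ⊗_) (K₁₂ k j)))
      (Σ-unitʳ d (λ k → ev n F i (r ↑ʳ k)) (λ k → K (r ↑ʳ k) (r ↑ʳ j)) j (λ k → K₂₂ k j)))
      (ev-periodic-split F i j)

    K·K⁻¹ : K · K⁻¹ ≋ δ
    K·K⁻¹ = by-halves r d
      (λ i → by-halves r d
        (λ k → trans (K·-top K⁻¹ i (k ↑ˡ d)) (trans
          (cong₂ _⊕_ (B₁₁ i k) (B₂₁ (π (i ↑ˡ d)) k))
          (trans (ℤₚ.+-identityʳ (δ i k)) (sym (δ-↑ˡ d i k)))))
        (λ k → trans (K·-top K⁻¹ i (r ↑ʳ k)) (trans
          (cong₂ _⊕_ (B₁₂ i k) (B₂₂ (π (i ↑ˡ d)) k))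
          (trans (ℤₚ.+-inverseˡ (E i k)) (sym (δ-↑ˡ-↑ʳ i k))))))
      (λ i → by-halves r d
        (λ k → trans (K·-bottom K⁻¹ i (k ↑ˡ d)) (trans (B₂₁ i k) (sym (δ-↑ʳ-↑ˡ i k))))
        (λ k → trans (K·-bottom K⁻¹ i (r ↑ʳ k)) (trans (B₂₂ i k) (sym (δ-↑ʳ r i k)))))
      where
      B₁₁ = blocks₁₁ {r} {d} δ (λ i j → ⊖ E i j) (λ _ _ → 0ℤ) δ
      B₁₂ = blocks₁₂ {r} {d} δ (λ i j → ⊖ E i j) (λ _ _ → 0ℤ) δ
      B₂₁ = blocks₂₁ {r} {d} δ (λ i j → ⊖ E i j) (λ _ _ → 0ℤ) δ
      B₂₂ = blocks₂₂ {r} {d} δ (λ i j → ⊖ E i j) (λ _ _ → 0ℤ) δ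

    ev·K : ∀ F → ev n F · K ≋ K · T F
    ev·K F = by-halves r d
      (λ i → by-halves r d
        (λ k → trans (·K-left (ev n F) (i ↑ˡ d) k) (sym (trans (K·-top (T F) i (k ↑ˡ d)) (trans
          (cong₂ _⊕_ (T₁₁ i k) (T₂₁ (π (i ↑ˡ d)) k))
          (cancel (ev n F (i ↑ˡ d) (k ↑ˡ d)) (ev n F (ρ i) (k ↑ˡ d)))))))
        (λ k → trans (·K-right F (i ↑ˡ d) k) (sym (trans (K·-top (T F) i (r ↑ʳ k)) (trans
          (cong₂ _⊕_ (T₁₂ i k) (T₂₂ (π (i ↑ˡ d)) k))
          (ℤₚ.+-identityˡ (ev d F (π (i ↑ˡ d)) k)))))))
      (λ i → by-halves r d
        (λ k → trans (·K-left (ev n F) (r ↑ʳ i) k) (sym (trans (K·-bottom (T F) i (k ↑ˡ d)) (T₂₁ i k))))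
        (λ k → trans (·K-right F (r ↑ʳ i) k) (sym (trans (K·-bottom (T F) i (r ↑ʳ k)) (trans (T₂₂ i k)
          (cong (λ z → ev d F z k) (sym (π-↑ʳ i))))))))
      where
      T₁₁ = blocks₁₁ {r} {d} (quot F) (λ _ _ → 0ℤ) (λ i k → ev n F (r ↑ʳ i) (k ↑ˡ d)) (ev d F)
      T₁₂ = blocks₁₂ {r} {d} (quot F) (λ _ _ → 0ℤ) (λ i k → ev n F (r ↑ʳ i) (k ↑ˡ d)) (ev d F)
      T₂₁ = blocks₂₁ {r} {d} (quot F) (λ _ _ → 0ℤ) (λ i k → ev n F (r ↑ʳ i) (k ↑ˡ d)) (ev d F)
      T₂₂ = blocks₂₂ {r} {d} (quot F) (λ _ _ → 0ℤ) (λ i k → ev n F (r ↑ʳ i) (k ↑ˡ d)) (ev d F)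
      cancel : ∀ x y → (x ⊝ y) ⊕ y ≡ x
      cancel = solve-∀

    det-T : ∀ F → det n (T F) ≡ relNorm F ⊗ det d (ev d F)
    det-T F = trans
      (det-block r d (T F) (blocks₁₂ {r} {d} (quot F) (λ _ _ → 0ℤ) (λ i k → ev n F (r ↑ʳ i) (k ↑ˡ d)) (ev d F)))
      (cong₂ _⊗_
        (det-cong r (blocks₁₁ {r} {d} (quot F) (λ _ _ → 0ℤ) (λ i k → ev n F (r ↑ʳ i) (k ↑ˡ d)) (ev d F)))
        (det-cong d (blocks₂₂ {r} {d} (quot F) (λ _ _ → 0ℤ) (λ i k → ev n F (r ↑ʳ i) (k ↑ˡ d)) (ev d F))))

  -- By `ev·K` the matrices `ev n F` and `T F` are conjugate under `K`. The value of `det n K` is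
  -- never computed: it cancels against `det n K⁻¹`.
  det-factor : ∀ F → det n (ev n F) ≡ relNorm F ⊗ det d (ev d F)
  det-factor F = begin
    det n (ev n F)
      ≡⟨ insert (det n (ev n F)) ⟩
    (det n (ev n F) ⊗ det n K) ⊗ det n K⁻¹
      ≡⟨ cong (_⊗ det n K⁻¹) (trans (sym (det-· n (ev n F) K)) (trans (det-cong n (ev·K F)) (det-· n K (T F)))) ⟩
    (det n K ⊗ det n (T F)) ⊗ det n K⁻¹
      ≡⟨ cong (_⊗ det n K⁻¹) (ℤₚ.*-comm (det n K) (det n (T F))) ⟩
    (det n (T F) ⊗ det n K) ⊗ det n K⁻¹
      ≡⟨ insert (det n (T F)) ⟨
    det n (T F)
      ≡⟨ det-T F ⟩
    relNorm F ⊗ det d (ev d F) ∎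
    where
    insert : ∀ x → x ≡ (x ⊗ det n K) ⊗ det n K⁻¹
    insert x = sym (trans (ℤₚ.*-assoc x (det n K) (det n K⁻¹)) (trans
      (cong (x ⊗_) (trans (sym (det-· n K K⁻¹)) (trans (det-cong n K·K⁻¹) (det-δ n)))) (ℤₚ.*-identityʳ x)))

  -- The rows `i` and `ρ i` of `ev n F` have the same sum over each residue class, so their
  -- difference `Δ` sums to zero over each class (`Δ-balance`). Eliminating the last `d` entries of
  -- `Δ` replaces the entry of `G` at `k` by its difference with the entry at `ρ k`.
  quot-⊡ : ∀ F G → quot (F ⊡ G) ≋ quot F · quot G
  quot-⊡ F G i l = begin
    ev n (F ⊡ G) (i ↑ˡ d) l′ ⊝ ev n (F ⊡ G) (ρ i) l′
      ≡⟨ cong₂ _⊝_ (ev-⊡ F G (i ↑ˡ d) l′) (ev-⊡ F G (ρ i) l′) ⟩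
    (ev n F · ev n G) (i ↑ˡ d) l′ ⊝ (ev n F · ev n G) (ρ i) l′
      ≡⟨ Σ-diff ⟩
    Σ-fin n (λ x → Δ x ⊗ B x)
      ≡⟨ Σ-split r d (λ x → Δ x ⊗ B x) ⟩
    Σ-fin r (λ k → Δ (k ↑ˡ d) ⊗ B (k ↑ˡ d)) ⊕ Σ-fin d (λ j → Δ (r ↑ʳ j) ⊗ B (r ↑ʳ j))
      ≡⟨ cong (Σ-fin r (λ k → Δ (k ↑ˡ d) ⊗ B (k ↑ˡ d)) ⊕_) tail ⟩
    Σ-fin r (λ k → Δ (k ↑ˡ d) ⊗ B (k ↑ˡ d)) ⊕ Σ-fin r (λ k → ⊖ (Δ (k ↑ˡ d) ⊗ B (ρ k)))
      ≡⟨ Σ-+ r (λ k → Δ (k ↑ˡ d) ⊗ B (k ↑ˡ d)) (λ k → ⊖ (Δ (k ↑ˡ d) ⊗ B (ρ k))) ⟨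
    Σ-fin r (λ k → Δ (k ↑ˡ d) ⊗ B (k ↑ˡ d) ⊕ ⊖ (Δ (k ↑ˡ d) ⊗ B (ρ k)))
      ≡⟨ Σ-cong r (λ k → factor (Δ (k ↑ˡ d)) (B (k ↑ˡ d)) (B (ρ k))) ⟩
    (quot F · quot G) i l ∎
    where
    l′ = l ↑ˡ d
    B : Fin n → ℤ
    B x = ev n G x l′
    Δ : Fin n → ℤ
    Δ x = ev n F (i ↑ˡ d) x ⊝ ev n F (ρ i) x
    factor : ∀ a b c → a ⊗ b ⊕ ⊖ (a ⊗ c) ≡ a ⊗ (b ⊝ c)
    factor = solve-∀
    linear : ∀ x y b → x ⊗ b ⊝ y ⊗ b ≡ (x ⊝ y) ⊗ b
    linear = solve-∀
    Σ-⊝ : ∀ m (f g : Fin m → ℤ) → Σ-fin m f ⊝ Σ-fin m g ≡ Σ-fin m (λ k → f k ⊝ g k)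
    Σ-⊝ m f g = begin
      Σ-fin m f ⊝ Σ-fin m g                    ≡⟨ scalars (Σ-fin m f) (Σ-fin m g) ⟩
      1ℤ ⊗ Σ-fin m f ⊕ -1ℤ ⊗ Σ-fin m g         ≡⟨ Σ-linear m 1ℤ -1ℤ f g ⟨
      Σ-fin m (λ k → 1ℤ ⊗ f k ⊕ -1ℤ ⊗ g k)     ≡⟨ Σ-cong m (λ k → sym (scalars (f k) (g k))) ⟩
      Σ-fin m (λ k → f k ⊝ g k)                ∎
      where
      scalars : ∀ x y → x ⊝ y ≡ 1ℤ ⊗ x ⊕ -1ℤ ⊗ y
      scalars = solve-∀
    Σ-diff : (ev n F · ev n G) (i ↑ˡ d) l′ ⊝ (ev n F · ev n G) (ρ i) l′ ≡ Σ-fin n (λ x → Δ x ⊗ B x)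
    Σ-diff = trans (Σ-⊝ n (λ x → ev n F (i ↑ˡ d) x ⊗ B x) (λ x → ev n F (ρ i) x ⊗ B x))
      (Σ-cong n (λ x → linear (ev n F (i ↑ˡ d) x) (ev n F (ρ i) x) (B x)))
    Δ-balance : ∀ j → Δ (r ↑ʳ j) ≡ ⊖ Σ-fin r (λ k → Δ (k ↑ˡ d) ⊗ E k j)
    Δ-balance j = begin
      ev n F (i ↑ˡ d) (r ↑ʳ j) ⊝ ev n F (ρ i) (r ↑ʳ j)
        ≡⟨ isolate (S (i ↑ˡ d)) (S (ρ i)) (ev n F (i ↑ˡ d) (r ↑ʳ j)) (ev n F (ρ i) (r ↑ʳ j)) (begin
             S (i ↑ˡ d) ⊕ ev n F (i ↑ˡ d) (r ↑ʳ j)   ≡⟨ ev-periodic-split F (i ↑ˡ d) j ⟩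
             ev d F (π (i ↑ˡ d)) j                   ≡⟨ cong (λ z → ev d F z j) (sym (π-↑ʳ (π (i ↑ˡ d)))) ⟩
             ev d F (π (ρ i)) j                      ≡⟨ ev-periodic-split F (ρ i) j ⟨
             S (ρ i) ⊕ ev n F (ρ i) (r ↑ʳ j)         ∎) ⟩
      ⊖ (S (i ↑ˡ d) ⊝ S (ρ i))
        ≡⟨ cong ⊖_ (trans (Σ-⊝ r (λ k → ev n F (i ↑ˡ d) (k ↑ˡ d) ⊗ E k j) (λ k → ev n F (ρ i) (k ↑ˡ d) ⊗ E k j))
             (Σ-cong r (λ k → linear (ev n F (i ↑ˡ d) (k ↑ˡ d)) (ev n F (ρ i) (k ↑ˡ d)) (E k j)))) ⟩
      ⊖ Σ-fin r (λ k → Δ (k ↑ˡ d) ⊗ E k j) ∎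
      where
      S : Fin n → ℤ
      S x = Σ-fin r (λ k → ev n F x (k ↑ˡ d) ⊗ E k j)
      isolate : ∀ s t a b → s ⊕ a ≡ t ⊕ b → a ⊝ b ≡ ⊖ (s ⊝ t)
      isolate s t a b eq = trans (id₁ s a b) (trans (cong (λ z → z ⊝ s ⊝ b) eq) (id₂ s t b))
        where
        id₁ : ∀ s a b → a ⊝ b ≡ (s ⊕ a) ⊝ s ⊝ b
        id₁ = solve-∀
        id₂ : ∀ s t b → (t ⊕ b) ⊝ s ⊝ b ≡ ⊖ (s ⊝ t)
        id₂ = solve-∀
    negʳ : ∀ x y → (⊖ x) ⊗ y ≡ -1ℤ ⊗ (x ⊗ y)
    negʳ = solve-∀
    neg : ∀ x → -1ℤ ⊗ x ≡ ⊖ x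
    neg = solve-∀
    tail : Σ-fin d (λ j → Δ (r ↑ʳ j) ⊗ B (r ↑ʳ j)) ≡ Σ-fin r (λ k → ⊖ (Δ (k ↑ˡ d) ⊗ B (ρ k)))
    tail = begin
      Σ-fin d (λ j → Δ (r ↑ʳ j) ⊗ B (r ↑ʳ j))
        ≡⟨ Σ-cong d (λ j → trans (cong (_⊗ B (r ↑ʳ j)) (Δ-balance j)) (negʳ (Σ-fin r (λ k → Δ (k ↑ˡ d) ⊗ E k j)) (B (r ↑ʳ j)))) ⟩
      Σ-fin d (λ j → -1ℤ ⊗ (Σ-fin r (λ k → Δ (k ↑ˡ d) ⊗ E k j) ⊗ B (r ↑ʳ j)))
        ≡⟨ Σ-*ˡ d -1ℤ (λ j → Σ-fin r (λ k → Δ (k ↑ˡ d) ⊗ E k j) ⊗ B (r ↑ʳ j)) ⟩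
      -1ℤ ⊗ Σ-fin d (λ j → Σ-fin r (λ k → Δ (k ↑ˡ d) ⊗ E k j) ⊗ B (r ↑ʳ j))
        ≡⟨ cong (-1ℤ ⊗_) (begin
             Σ-fin d (λ j → Σ-fin r (λ k → Δ (k ↑ˡ d) ⊗ E k j) ⊗ B (r ↑ʳ j))
               ≡⟨ Σ-cong d (λ j → sym (Σ-*ʳ r (B (r ↑ʳ j)) (λ k → Δ (k ↑ˡ d) ⊗ E k j))) ⟩
             Σ-fin d (λ j → Σ-fin r (λ k → Δ (k ↑ˡ d) ⊗ E k j ⊗ B (r ↑ʳ j)))
               ≡⟨ Σ-swap d r (λ j k → Δ (k ↑ˡ d) ⊗ E k j ⊗ B (r ↑ʳ j)) ⟩
             Σ-fin r (λ k → Σ-fin d (λ j → Δ (k ↑ˡ d) ⊗ E k j ⊗ B (r ↑ʳ j)))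
               ≡⟨ Σ-cong r (λ k → trans (Σ-cong d (λ j → ℤₚ.*-assoc (Δ (k ↑ˡ d)) (E k j) (B (r ↑ʳ j))))
                    (trans (Σ-*ˡ d (Δ (k ↑ˡ d)) (λ j → E k j ⊗ B (r ↑ʳ j)))
                      (cong (Δ (k ↑ˡ d) ⊗_) (Σ-δˡ d (π (k ↑ˡ d)) (λ j → B (r ↑ʳ j)))))) ⟩
             Σ-fin r (λ k → Δ (k ↑ˡ d) ⊗ B (ρ k)) ∎) ⟩
      -1ℤ ⊗ Σ-fin r (λ k → Δ (k ↑ˡ d) ⊗ B (ρ k))
        ≡⟨ Σ-*ˡ r -1ℤ (λ k → Δ (k ↑ˡ d) ⊗ B (ρ k)) ⟨
      Σ-fin r (λ k → -1ℤ ⊗ (Δ (k ↑ˡ d) ⊗ B (ρ k)))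
        ≡⟨ Σ-cong r (λ k → neg (Δ (k ↑ˡ d) ⊗ B (ρ k))) ⟩
      Σ-fin r (λ k → ⊖ (Δ (k ↑ˡ d) ⊗ B (ρ k))) ∎

  relNorm-⊡ : ∀ F G → relNorm (F ⊡ G) ≡ relNorm F ⊗ relNorm G
  relNorm-⊡ F G = trans (det-cong r (quot-⊡ F G)) (det-· r (quot F) (quot G))

  relNorm-cong : ∀ {F G} → F ≈[ n ] G → relNorm F ≡ relNorm G
  relNorm-cong F≈G = det-cong r (λ i k → cong₂ _⊝_ (F≈G (i ↑ˡ d) (k ↑ˡ d)) (F≈G (ρ i) (k ↑ˡ d)))

  relNorm-one : relNorm one ≡ 1ℤ
  relNorm-one = trans
    (det-cong r (λ i k → trans
      (cong₂ _⊝_ (trans (ev-one (i ↑ˡ d) (k ↑ˡ d)) (δ-↑ˡ d i k)) (trans (ev-one (ρ i) (k ↑ˡ d)) (δ-↑ʳ-↑ˡ (π (i ↑ˡ d)) k)))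
      (ℤₚ.+-identityʳ (δ i k))))
    (det-δ r)

  -- The condition x^d N = N says that `N` is a multiple of 1 + x^d + ... + x^{n-d}; such elements
  -- act as zero on the quotient lattice.
  Periodic : Poly → Set
  Periodic N = shift d N ≈[ n ] N

  quot-periodic : ∀ N → Periodic N → ∀ i k → ev n N (i ↑ˡ d) k ≡ ev n N (ρ i) k
  quot-periodic N periodic i k = begin
    ev n N (i ↑ˡ d) k                        ≡⟨ cong (λ z → ev n N z k) return ⟨
    ev n N (next^ (suc t * d) (ρ i)) k       ≡⟨ steps (suc t) (ρ i) ⟩
    ev n N (ρ i) k                           ∎
    where
    t = toℕ i / d
    steps : ∀ t x → ev n N (next^ (t * d) x) k ≡ ev n N x k
    steps zero    x = refl
    steps (suc t) x = trans (cong (λ z → ev n N z k) (next^-+ d (t * d) x))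
      (trans (steps t (next^ d x)) (trans (sym (ev-shift d N x k)) (periodic x k)))
    -- `ρ i` is `r + i % d`; one period leads to `n + i % d`, which wraps around to `i % d`, and `t`
    -- further periods lead to `i`.
    return : next^ (suc t * d) (ρ i) ≡ i ↑ˡ d
    return = F.toℕ-injective (begin
      toℕ (next^ (suc t * d) (ρ i))           ≡⟨ toℕ-next^ (suc t * d) (ρ i) ⟩
      (toℕ (ρ i) + (d + t * d)) % n           ≡⟨ cong (λ z → (z + (d + t * d)) % n) (trans (F.toℕ-↑ʳ r (π (i ↑ˡ d)))
                                                   (cong (λ z → r + z) (trans (toℕ-mod (toℕ (i ↑ˡ d)) d-1) (cong (_% d) (F.toℕ-↑ˡ i d))))) ⟩
      (r + toℕ i % d + (d + t * d)) % n       ≡⟨ cong (_% n) (rearrange r (toℕ i % d) d (t * d)) ⟩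
      (toℕ i % d + t * d + n) % n             ≡⟨ DM.[m+n]%n≡m%n (toℕ i % d + t * d) n ⟩
      (toℕ i % d + t * d) % n                 ≡⟨ cong (_% n) (DM.m≡m%n+[m/n]*n (toℕ i) d) ⟨
      toℕ i % n                               ≡⟨ DM.m<n⇒m%n≡m (ℕₚ.<-≤-trans (F.toℕ<n i) (ℕₚ.m≤m+n r d)) ⟩
      toℕ i                                   ≡⟨ F.toℕ-↑ˡ i d ⟨
      toℕ (i ↑ˡ d)                            ∎)
      where
      rearrange : ∀ a b c e → a + b + (c + e) ≡ b + e + (a + c)
      rearrange = ℕ-solve-∀

  relNorm-periodic : ∀ F N → Periodic N → relNorm (F ⊞ N) ≡ relNorm F
  relNorm-periodic F N periodic = det-cong r (λ i k → begin
    ev n (F ⊞ N) (i ↑ˡ d) (k ↑ˡ d) ⊝ ev n (F ⊞ N) (ρ i) (k ↑ˡ d)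
      ≡⟨ cong₂ _⊝_ (ev-⊞ F N (i ↑ˡ d) (k ↑ˡ d)) (ev-⊞ F N (ρ i) (k ↑ˡ d)) ⟩
    (ev n F (i ↑ˡ d) (k ↑ˡ d) ⊕ ev n N (i ↑ˡ d) (k ↑ˡ d)) ⊝ (ev n F (ρ i) (k ↑ˡ d) ⊕ ev n N (ρ i) (k ↑ˡ d))
      ≡⟨ cong (λ z → (ev n F (i ↑ˡ d) (k ↑ˡ d) ⊕ z) ⊝ (ev n F (ρ i) (k ↑ˡ d) ⊕ ev n N (ρ i) (k ↑ˡ d))) (quot-periodic N periodic i (k ↑ˡ d)) ⟩
    (ev n F (i ↑ˡ d) (k ↑ˡ d) ⊕ ev n N (ρ i) (k ↑ˡ d)) ⊝ (ev n F (ρ i) (k ↑ˡ d) ⊕ ev n N (ρ i) (k ↑ˡ d))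
      ≡⟨ cancel (ev n F (i ↑ˡ d) (k ↑ˡ d)) (ev n F (ρ i) (k ↑ˡ d)) (ev n N (ρ i) (k ↑ˡ d)) ⟩
    quot F i k ∎)
    where
    cancel : ∀ x y z → (x ⊕ z) ⊝ (y ⊕ z) ≡ x ⊝ y
    cancel = solve-∀

  relNorm-unit : ∀ F G N → Periodic N → F ⊡ G ≈[ n ] one ⊞ N → relNorm F ⊗ relNorm G ≡ 1ℤ
  relNorm-unit F G N periodic FG≈ = begin
    relNorm F ⊗ relNorm G    ≡⟨ relNorm-⊡ F G ⟨
    relNorm (F ⊡ G)          ≡⟨ relNorm-cong {F ⊡ G} {one ⊞ N} FG≈ ⟩
    relNorm (one ⊞ N)        ≡⟨ relNorm-periodic one N periodic ⟩
    relNorm one              ≡⟨ relNorm-one ⟩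
    1ℤ                       ∎

-- Geometric sums and cyclotomic units.

-- geo s k = 1 + xˢ + x²ˢ + … + x⁽ᵏ⁻¹⁾ˢ
geo : ℕ → ℕ → Poly
geo s zero    = []
geo s (suc k) = one ⊞ shift s (geo s k)

module _ {n : ℕ} where

  ⊡-one⊞shift : ∀ s F G (i k : Fin n) →
    ev n ((one ⊞ shift s F) ⊡ G) i k ≡ ev n G i k ⊕ ev n (F ⊡ G) (next^ s i) k
  ⊡-one⊞shift s F G i k = begin
    ev n ((one ⊞ shift s F) ⊡ G) i k
      ≡⟨ ev-⊡ (one ⊞ shift s F) G i k ⟩
    Σ-fin n (λ j → ev n (one ⊞ shift s F) i j ⊗ ev n G j k)
      ≡⟨ Σ-cong n (λ j → trans
           (cong (_⊗ ev n G j k) (trans (ev-⊞ one (shift s F) i j) (cong₂ _⊕_ (ev-one i j) (ev-shift s F i j))))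
           (ℤₚ.*-distribʳ-+ (ev n G j k) (δ i j) (ev n F (next^ s i) j))) ⟩
    Σ-fin n (λ j → δ i j ⊗ ev n G j k ⊕ ev n F (next^ s i) j ⊗ ev n G j k)
      ≡⟨ Σ-+ n (λ j → δ i j ⊗ ev n G j k) (λ j → ev n F (next^ s i) j ⊗ ev n G j k) ⟩
    Σ-fin n (λ j → δ i j ⊗ ev n G j k) ⊕ Σ-fin n (λ j → ev n F (next^ s i) j ⊗ ev n G j k)
      ≡⟨ cong₂ _⊕_ (Σ-δˡ n i (λ j → ev n G j k)) (sym (ev-⊡ F G (next^ s i) k)) ⟩
    ev n G i k ⊕ ev n (F ⊡ G) (next^ s i) k ∎

  ev-geo-suc : ∀ s k (i l : Fin n) → ev n (geo s (suc k)) i l ≡ δ i l ⊕ ev n (geo s k) (next^ s i) l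
  ev-geo-suc s k i l = trans (ev-⊞ one (shift s (geo s k)) i l) (cong₂ _⊕_ (ev-one i l) (ev-shift s (geo s k) i l))

  ev-geo-+ : ∀ s k j (i l : Fin n) →
    ev n (geo s (k + j)) i l ≡ ev n (geo s k) i l ⊕ ev n (geo s j) (next^ (k * s) i) l
  ev-geo-+ s zero    j i l = sym (ℤₚ.+-identityˡ (ev n (geo s j) i l))
  ev-geo-+ s (suc k) j i l = begin
    ev n (geo s (suc k + j)) i l
      ≡⟨ ev-geo-suc s (k + j) i l ⟩
    δ i l ⊕ ev n (geo s (k + j)) (next^ s i) l
      ≡⟨ cong (δ i l ⊕_) (ev-geo-+ s k j (next^ s i) l) ⟩
    δ i l ⊕ (ev n (geo s k) (next^ s i) l ⊕ ev n (geo s j) (next^ (k * s) (next^ s i)) l)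
      ≡⟨ ℤₚ.+-assoc (δ i l) (ev n (geo s k) (next^ s i) l) (ev n (geo s j) (next^ (k * s) (next^ s i)) l) ⟨
    (δ i l ⊕ ev n (geo s k) (next^ s i) l) ⊕ ev n (geo s j) (next^ (k * s) (next^ s i)) l
      ≡⟨ cong₂ _⊕_ (sym (ev-geo-suc s k i l)) (cong (λ z → ev n (geo s j) z l) (sym (next^-+ s (k * s) i))) ⟩
    ev n (geo s (suc k)) i l ⊕ ev n (geo s j) (next^ (suc k * s) i) l ∎

  -- Division with remainder by `k` writes each number below `j * k` uniquely as a multiple of `k`
  -- plus a digit below `k`.
  geo-⊡ : ∀ s j k → geo (k * s) j ⊡ geo s k ≈[ n ] geo s (j * k)
  geo-⊡ s zero    k i l = refl
  geo-⊡ s (suc j) k i l = begin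
    ev n (geo (k * s) (suc j) ⊡ geo s k) i l
      ≡⟨ ⊡-one⊞shift (k * s) (geo (k * s) j) (geo s k) i l ⟩
    ev n (geo s k) i l ⊕ ev n (geo (k * s) j ⊡ geo s k) (next^ (k * s) i) l
      ≡⟨ cong (ev n (geo s k) i l ⊕_) (geo-⊡ s j k (next^ (k * s) i) l) ⟩
    ev n (geo s k) i l ⊕ ev n (geo s (j * k)) (next^ (k * s) i) l
      ≡⟨ ev-geo-+ s k (j * k) i l ⟨
    ev n (geo s (suc j * k)) i l ∎

  -- Since `n ∣ k * s`, multiplication by xˢ permutes the terms cyclically. The proof splits the sum
  -- of `suc k` terms once at the front and once at the back.
  geo-periodic : ∀ s k → n ∣ k * s → shift s (geo s k) ≈[ n ] geo s k
  geo-periodic s k n∣ks i l = ℤ-cancel (δ i l) (ev n (shift s (geo s k)) i l) (ev n (geo s k) i l) (begin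
    δ i l ⊕ ev n (shift s (geo s k)) i l
      ≡⟨ cong (δ i l ⊕_) (ev-shift s (geo s k) i l) ⟩
    δ i l ⊕ ev n (geo s k) (next^ s i) l
      ≡⟨ ev-geo-suc s k i l ⟨
    ev n (geo s (suc k)) i l
      ≡⟨ cong (λ z → ev n (geo s z) i l) (ℕₚ.+-comm 1 k) ⟩
    ev n (geo s (k + 1)) i l
      ≡⟨ ev-geo-+ s k 1 i l ⟩
    ev n (geo s k) i l ⊕ ev n (geo s 1) (next^ (k * s) i) l
      ≡⟨ cong (λ z → ev n (geo s k) i l ⊕ ev n (geo s 1) z l) (next^-period (k * s) i n∣ks) ⟩
    ev n (geo s k) i l ⊕ ev n (geo s 1) i l
      ≡⟨ cong (ev n (geo s k) i l ⊕_) (trans (ev-geo-suc s 0 i l) (ℤₚ.+-identityʳ (δ i l))) ⟩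
    ev n (geo s k) i l ⊕ δ i l ∎)
    where
    ℤ-cancel : ∀ e x y → e ⊕ x ≡ y ⊕ e → x ≡ y
    ℤ-cancel e x y eq = trans (id₁ e x) (trans (cong (_⊝ e) eq) (id₂ e y))
      where
      id₁ : ∀ e x → x ≡ (e ⊕ x) ⊝ e
      id₁ = solve-∀
      id₂ : ∀ e y → (y ⊕ e) ⊝ e ≡ y
      id₂ = solve-∀

  shift-cong : ∀ s {F G} → F ≈[ n ] G → shift s F ≈[ n ] shift s G
  shift-cong s {F} {G} F≈G i k = trans (ev-shift s F i k) (trans (F≈G (next^ s i) k) (sym (ev-shift s G i k)))

  ◂-periodic : ∀ s c F → shift s F ≈[ n ] F → shift s (c ◂ F) ≈[ n ] c ◂ F
  ◂-periodic s c F sF≈F i k = begin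
    ev n (shift s (c ◂ F)) i k     ≡⟨ ev-shift s (c ◂ F) i k ⟩
    ev n (c ◂ F) (next^ s i) k     ≡⟨ ev-◂ c F (next^ s i) k ⟩
    c ⊗ ev n F (next^ s i) k       ≡⟨ cong (c ⊗_) (trans (sym (ev-shift s F i k)) (sF≈F i k)) ⟩
    c ⊗ ev n F i k                 ≡⟨ ev-◂ c F i k ⟨
    ev n (c ◂ F) i k               ∎

  ⊡-periodic : ∀ s F G → shift s F ≈[ n ] F → shift s (F ⊡ G) ≈[ n ] F ⊡ G
  ⊡-periodic s F G sF≈F i k = begin
    ev n (shift s (F ⊡ G)) i k                              ≡⟨ ev-shift s (F ⊡ G) i k ⟩
    ev n (F ⊡ G) (next^ s i) k                              ≡⟨ ev-⊡ F G (next^ s i) k ⟩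
    Σ-fin n (λ j → ev n F (next^ s i) j ⊗ ev n G j k)       ≡⟨ Σ-cong n (λ j → cong (_⊗ ev n G j k) (trans (sym (ev-shift s F i j)) (sF≈F i j))) ⟩
    Σ-fin n (λ j → ev n F i j ⊗ ev n G j k)                 ≡⟨ ev-⊡ F G i k ⟨
    ev n (F ⊡ G) i k                                        ∎

-- The product telescopes to `suc w` terms: the leading 1 and a sum over `w` terms that xˢ fixes.
-- Hence `geo s k` is invertible modulo elements fixed by xˢ, with inverse `geo (k * s) k′`.
geo-unit : ∀ {n} s k k′ w → k′ * k ≡ suc w → n ∣ w * s →
  (geo (k * s) k′ ⊡ geo s k ≈[ n ] one ⊞ shift s (geo s w)) × (shift s (shift s (geo s w)) ≈[ n ] shift s (geo s w))
geo-unit {n} s k k′ w k′k≡ n∣ws =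
  (λ i l → trans (geo-⊡ s k′ k i l) (cong (λ z → ev n (geo s z) i l) k′k≡)) ,
  shift-cong s {shift s (geo s w)} {geo s w} (geo-periodic s w n∣ws)

-- The value at 1 and the norm of 1 - x.

-- the value at x = 1
ε : Poly → ℤ
ε F = ev 1 F fzero fzero

ε-⊡ : ∀ F G → ε (F ⊡ G) ≡ ε F ⊗ ε G
ε-⊡ F G = trans (ev-⊡ F G fzero fzero) (ℤₚ.+-identityʳ (ε F ⊗ ε G))

Fin1 : (i : Fin 1) → i ≡ fzero
Fin1 fzero = refl

ε-geo : ∀ s k → ε (geo s k) ≡ + k
ε-geo s zero    = refl
ε-geo s (suc k) = trans (ev-geo-suc s k fzero fzero)
  (cong (1ℤ ⊕_) (trans (cong (λ z → ev 1 (geo s k) z fzero) (Fin1 (next^ s fzero))) (ε-geo s k)))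

circDet : ℕ → Poly → ℤ
circDet n F = det n (ev n F)

1-x : Poly
1-x = 1ℤ ∷ -1ℤ ∷ []

δ-toℕ : ∀ {m n} (i k : Fin m) (i′ k′ : Fin n) → toℕ i ≡ toℕ i′ → toℕ k ≡ toℕ k′ → δ i k ≡ δ i′ k′
δ-toℕ fzero    fzero    fzero     fzero     _  _  = refl
δ-toℕ fzero    (fsuc k) fzero     (fsuc k′) _  _  = refl
δ-toℕ (fsuc i) fzero    (fsuc i′) fzero     _  _  = refl
δ-toℕ (fsuc i) (fsuc k) (fsuc i′) (fsuc k′) eq eq′ = δ-toℕ i k i′ k′ (ℕₚ.suc-injective eq) (ℕₚ.suc-injective eq′)

-- Rows (w, -1, 0, …), (u, 1, -1, 0, …), (u, 0, 1, -1, 0, …), …, (u, 0, …, 0, 1).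
bordered : ∀ {m} → ℤ → ℤ → Mat m
bordered w u fzero    fzero    = w
bordered w u (fsuc i) fzero    = u
bordered w u i        (fsuc k) = δ i (fsuc k) ⊝ δ i (inject₁ k)

-- Only the first two entries of the first row are nonzero. Their minors are bordered again, with
-- parameters `1ℤ`, `0ℤ` and `u`, `u`, which closes the induction.
det-bordered : ∀ m w u → det (suc m) (bordered w u) ≡ w ⊕ + m ⊗ u
det-bordered zero    w u = base w u
  where
  base : ∀ w u → 1ℤ ⊗ (w ⊗ 1ℤ) ⊕ 0ℤ ≡ w ⊕ 0ℤ ⊗ u
  base = solve-∀
det-bordered (suc m) w u = begin
  det (suc (suc m)) (bordered w u)
    ≡⟨⟩
  1ℤ ⊗ (w ⊗ det (suc m) (minor (bordered w u) fzero)) ⊕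
    (-1ℤ ⊗ (-1ℤ ⊗ det (suc m) (minor (bordered w u) (fsuc fzero))) ⊕ Σ-fin m (λ j → laplaceTerm (bordered w u) (fsuc (fsuc j))))
    ≡⟨ cong₂ (λ x y → 1ℤ ⊗ (w ⊗ x) ⊕ y)
         (trans (det-cong (suc m) minor₀) (det-bordered m 1ℤ 0ℤ))
         (cong₂ (λ x y → -1ℤ ⊗ (-1ℤ ⊗ x) ⊕ y)
           (trans (det-cong (suc m) minor₁) (det-bordered m u u))
           (Σ-zero m (λ j → ℤₚ.*-zeroʳ (sign (toℕ (fsuc (fsuc j))))))) ⟩
  1ℤ ⊗ (w ⊗ (1ℤ ⊕ + m ⊗ 0ℤ)) ⊕ (-1ℤ ⊗ (-1ℤ ⊗ (u ⊕ + m ⊗ u)) ⊕ 0ℤ)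
    ≡⟨ collect w u (+ m) ⟩
  w ⊕ (1ℤ ⊕ + m) ⊗ u ∎
  where
  collect : ∀ w u m → 1ℤ ⊗ (w ⊗ (1ℤ ⊕ m ⊗ 0ℤ)) ⊕ (-1ℤ ⊗ (-1ℤ ⊗ (u ⊕ m ⊗ u)) ⊕ 0ℤ) ≡ w ⊕ (1ℤ ⊕ m) ⊗ u
  collect = solve-∀
  minor₀ : minor (bordered w u) fzero ≋ bordered 1ℤ 0ℤ
  minor₀ fzero    fzero    = refl
  minor₀ (fsuc i) fzero    = refl
  minor₀ fzero    (fsuc k) = refl
  minor₀ (fsuc i) (fsuc k) = refl
  minor₁ : minor (bordered w u) (fsuc fzero) ≋ bordered u u
  minor₁ fzero    fzero    = refl
  minor₁ (fsuc i) fzero    = refl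
  minor₁ fzero    (fsuc k) = refl
  minor₁ (fsuc i) (fsuc k) = refl

module Augmentation (r : ℕ) where
  open Quotient r 0 (Dv.1∣ r) public

  circDet≡ : ∀ F → circDet n F ≡ relNorm F ⊗ ε F
  circDet≡ F = trans (det-factor F) (cong (relNorm F ⊗_) (collapse (ε F)))
    where
    collapse : ∀ x → 1ℤ ⊗ (x ⊗ 1ℤ) ⊕ 0ℤ ≡ x
    collapse = solve-∀

  -- This is the product of 1 - ζ over the n-th roots of unity ζ ≠ 1. For `r = suc m` the quotient
  -- matrix is `bordered (+ 2) 1ℤ`, of determinant 2 + m = n.
  relNorm-1-x : relNorm 1-x ≡ + n
  relNorm-1-x = go r refl
    where
    last : Fin n
    last = r ↑ʳ fzero
    ev-1-x : ∀ (i k : Fin n) → ev n 1-x i k ≡ δ i k ⊝ δ (next i) k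
    ev-1-x i k = simplify (δ i k) (δ (next i) k)
      where
      simplify : ∀ x y → 1ℤ ⊗ x ⊕ (-1ℤ ⊗ y ⊕ 0ℤ) ≡ x ⊝ y
      simplify = solve-∀
    toℕ-next-↑ˡ : ∀ (i : Fin r) → toℕ (next (i ↑ˡ 1)) ≡ suc (toℕ i)
    toℕ-next-↑ˡ i = trans (toℕ-next^ 1 (i ↑ˡ 1)) (trans
      (cong (_% n) (trans (cong (_+ 1) (F.toℕ-↑ˡ i 1)) (ℕₚ.+-comm (toℕ i) 1)))
      (DM.m<n⇒m%n≡m (subst (suc (toℕ i) <_) (ℕₚ.+-comm 1 r) (s≤s (F.toℕ<n i)))))
    toℕ-next-last : toℕ (next last) ≡ 0
    toℕ-next-last = trans (toℕ-next^ 1 last) (trans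
      (cong (λ z → (z + 1) % n) (trans (F.toℕ-↑ʳ r fzero) (ℕₚ.+-identityʳ r))) (DM.n%n≡0 n))
    entry : ∀ i k → quot 1-x i k ≡ δ i k ⊝ δ (fsuc i) (inject₁ k) ⊕ δ (next last) (k ↑ˡ 1)
    entry i k = begin
      ev n 1-x (i ↑ˡ 1) (k ↑ˡ 1) ⊝ ev n 1-x (ρ i) (k ↑ˡ 1)
        ≡⟨ cong₂ _⊝_ (ev-1-x (i ↑ˡ 1) (k ↑ˡ 1))
             (trans (cong (λ z → ev n 1-x (r ↑ʳ z) (k ↑ˡ 1)) (Fin1 (π (i ↑ˡ 1)))) (ev-1-x last (k ↑ˡ 1))) ⟩
      (δ (i ↑ˡ 1) (k ↑ˡ 1) ⊝ δ (next (i ↑ˡ 1)) (k ↑ˡ 1)) ⊝ (δ last (k ↑ˡ 1) ⊝ δ (next last) (k ↑ˡ 1))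
        ≡⟨ cong₂ (λ x y → (x ⊝ δ (next (i ↑ˡ 1)) (k ↑ˡ 1)) ⊝ (y ⊝ δ (next last) (k ↑ˡ 1))) (δ-↑ˡ 1 i k) (δ-↑ʳ-↑ˡ fzero k) ⟩
      (δ i k ⊝ δ (next (i ↑ˡ 1)) (k ↑ˡ 1)) ⊝ (0ℤ ⊝ δ (next last) (k ↑ˡ 1))
        ≡⟨ cong (λ z → (δ i k ⊝ z) ⊝ (0ℤ ⊝ δ (next last) (k ↑ˡ 1)))
             (δ-toℕ (next (i ↑ˡ 1)) (k ↑ˡ 1) (fsuc i) (inject₁ k) (toℕ-next-↑ˡ i) (trans (F.toℕ-↑ˡ k 1) (sym (F.toℕ-inject₁ k)))) ⟩
      (δ i k ⊝ δ (fsuc i) (inject₁ k)) ⊝ (0ℤ ⊝ δ (next last) (k ↑ˡ 1))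
        ≡⟨ simplify (δ i k ⊝ δ (fsuc i) (inject₁ k)) (δ (next last) (k ↑ˡ 1)) ⟩
      δ i k ⊝ δ (fsuc i) (inject₁ k) ⊕ δ (next last) (k ↑ˡ 1) ∎
      where
      simplify : ∀ x y → x ⊝ (0ℤ ⊝ y) ≡ x ⊕ y
      simplify = solve-∀
    go : ∀ m → m ≡ r → relNorm 1-x ≡ + n
    go zero    refl = refl
    go (suc m) refl = trans (det-cong (suc m) shape) (trans (det-bordered m (+ 2) 1ℤ)
      (trans (cong (+ 2 ⊕_) (ℤₚ.*-identityʳ (+ m))) (cong (λ z → + (suc z)) (ℕₚ.+-comm 1 m))))
      where
      corner : ∀ k → δ (next last) (k ↑ˡ 1) ≡ δ fzero k
      corner k = δ-toℕ (next last) (k ↑ˡ 1) fzero k toℕ-next-last (F.toℕ-↑ˡ k 1)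
      shape : quot 1-x ≋ bordered (+ 2) 1ℤ
      shape i k = trans (entry i k) (trans (cong (δ i k ⊝ δ (fsuc i) (inject₁ k) ⊕_) (corner k)) (compare i k))
        where
        compare : ∀ (i k : Fin (suc m)) → δ i k ⊝ δ (fsuc i) (inject₁ k) ⊕ δ fzero k ≡ bordered (+ 2) 1ℤ i k
        compare fzero    fzero    = refl
        compare (fsuc i) fzero    = refl
        compare fzero    (fsuc k) = ℤₚ.+-identityʳ (0ℤ ⊝ δ fzero (inject₁ k))
        compare (fsuc i) (fsuc k) = ℤₚ.+-identityʳ (δ i k ⊝ δ (fsuc i) (inject₁ k))

-- Absolute values of circulant determinants.

unit-abs : ∀ x y → x ⊗ y ≡ 1ℤ → abs x ≡ 1 × abs y ≡ 1
unit-abs x y xy≡1 = ℕₚ.m*n≡1⇒m≡1 (abs x) (abs y) eq , ℕₚ.m*n≡1⇒n≡1 (abs x) (abs y) eq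
  where
  eq : abs x * abs y ≡ 1
  eq = trans (sym (ℤₚ.abs-* x y)) (cong abs xy≡1)

-- `G` inverts `F` on the quotient by vectors of period `suc d-1`, so that factor of the determinant
-- is a unit of ℤ. Keeping `n` apart from `r + suc d-1` allows it to be given as a product.
circDet-unit : ∀ {n} r d-1 → suc d-1 ∣ r → n ≡ r + suc d-1 → ∀ F G N → shift (suc d-1) N ≈[ n ] N →
  G ⊡ F ≈[ n ] one ⊞ N → abs (circDet n F) ≡ abs (circDet (suc d-1) F)
circDet-unit r d-1 d∣r refl F G N periodic GF≈ = begin
  abs (circDet n F)                        ≡⟨ cong abs (det-factor F) ⟩
  abs (relNorm F ⊗ circDet d F)            ≡⟨ ℤₚ.abs-* (relNorm F) (circDet d F) ⟩
  abs (relNorm F) * abs (circDet d F)        ≡⟨ cong (_* abs (circDet d F)) (proj₂ (unit-abs (relNorm G) (relNorm F) (relNorm-unit G F N periodic GF≈))) ⟩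
  1 * abs (circDet d F)                    ≡⟨ ℕₚ.*-identityˡ (abs (circDet d F)) ⟩
  abs (circDet d F)                        ∎
  where open Quotient r d-1 d∣r

-- Away from x = 1, `U` is a unit with inverse `V`, so `F` has up to sign the norm of (1 - x)²,
-- which is the square of `relNorm 1-x`.
circDet-[1-x]² : ∀ {n} r → n ≡ r + 1 → ∀ F U V N₁ N₂ →
  shift 1 N₁ ≈[ n ] N₁ → F ⊡ U ≈[ n ] (1-x ⊡ 1-x) ⊞ N₁ →
  shift 1 N₂ ≈[ n ] N₂ → V ⊡ U ≈[ n ] one ⊞ N₂ →
  abs (circDet n F) ≡ n * n * abs (ε F)
circDet-[1-x]² r refl F U V N₁ N₂ periodic₁ FU≈ periodic₂ VU≈ = begin
  abs (circDet n F)                        ≡⟨ cong abs (circDet≡ F) ⟩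
  abs (relNorm F ⊗ ε F)                    ≡⟨ ℤₚ.abs-* (relNorm F) (ε F) ⟩
  abs (relNorm F) * abs (ε F)                ≡⟨ cong (_* abs (ε F)) norm ⟩
  n * n * abs (ε F)                        ∎
  where
  open Augmentation r
  norm : abs (relNorm F) ≡ n * n
  norm = begin
    abs (relNorm F)                        ≡⟨ ℕₚ.*-identityʳ (abs (relNorm F)) ⟨
    abs (relNorm F) * 1                    ≡⟨ cong (abs (relNorm F) *_) (proj₂ (unit-abs (relNorm V) (relNorm U) (relNorm-unit V U N₂ periodic₂ VU≈))) ⟨
    abs (relNorm F) * abs (relNorm U)        ≡⟨ ℤₚ.abs-* (relNorm F) (relNorm U) ⟨
    abs (relNorm F ⊗ relNorm U)            ≡⟨ cong abs (relNorm-⊡ F U) ⟨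
    abs (relNorm (F ⊡ U))                  ≡⟨ cong abs (relNorm-cong {F ⊡ U} {(1-x ⊡ 1-x) ⊞ N₁} FU≈) ⟩
    abs (relNorm ((1-x ⊡ 1-x) ⊞ N₁))       ≡⟨ cong abs (relNorm-periodic (1-x ⊡ 1-x) N₁ periodic₁) ⟩
    abs (relNorm (1-x ⊡ 1-x))              ≡⟨ cong abs (trans (relNorm-⊡ 1-x 1-x) (cong₂ _⊗_ relNorm-1-x relNorm-1-x)) ⟩
    abs (+ n ⊗ + n)                        ≡⟨ ℤₚ.abs-* (+ n) (+ n) ⟩
    n * n                                ∎

-- Multiplying by the unit 1 + x + … + xᵏ⁻¹ and adding a multiple of 1 + x + … + xⁿ⁻¹ changes the
-- value at x = 1 but, up to sign, not the product of the values at the other n-th roots of unity.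
circDet-adjust : ∀ {n} r → n ≡ r + 1 → ∀ F P → ε F ≢ 0ℤ → abs (circDet n F) ≡ P * P * abs (ε F) →
  ∀ k k′ w → k′ * k ≡ suc w → n ∣ w → ∀ c →
  ∃ λ σ → abs σ ≡ P * P × circDet n ((geo 1 k ⊡ F) ⊞ (c ◂ geo 1 n)) ≡ σ ⊗ (+ k ⊗ ε F ⊕ c ⊗ + n)
circDet-adjust r refl F P εF≢0 detF k k′ w k′k≡1+w n∣w c =
  relNorm F″ , norm , trans (circDet≡ F″) (cong (relNorm F″ ⊗_) augmentation)
  where
  open Augmentation r
  N F″ : Poly
  N  = c ◂ geo 1 n
  F″ = (geo 1 k ⊡ F) ⊞ N
  augmentation : ε F″ ≡ + k ⊗ ε F ⊕ c ⊗ + n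
  augmentation = trans (ev-⊞ (geo 1 k ⊡ F) N fzero fzero) (cong₂ _⊕_
    (trans (ε-⊡ (geo 1 k) F) (cong (_⊗ ε F) (ε-geo 1 k)))
    (trans (ev-◂ c (geo 1 n) fzero fzero) (cong (c ⊗_) (ε-geo 1 n))))
  unit : relNorm (geo (k * 1) k′) ⊗ relNorm (geo 1 k) ≡ 1ℤ
  unit = relNorm-unit (geo (k * 1) k′) (geo 1 k) (shift 1 (geo 1 w)) (proj₂ inverse) (proj₁ inverse)
    where inverse = geo-unit {n} 1 k k′ w k′k≡1+w (Dv.∣m⇒∣m*n 1 n∣w)
  instance
    εF≢0′ : ℕ.NonZero (abs (ε F))
    εF≢0′ = ℕ.≢-nonZero (λ eq → εF≢0 (ℤₚ.∣i∣≡0⇒i≡0 eq))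
  -- The determinant is `relNorm F ⊗ ε F`, and the nonzero factor `ε F` cancels from the hypothesis
  -- on it.
  normF : abs (relNorm F) ≡ P * P
  normF = ℕₚ.*-cancelʳ-≡ (abs (relNorm F)) (P * P) (abs (ε F))
    (trans (sym (ℤₚ.abs-* (relNorm F) (ε F))) (trans (cong abs (sym (circDet≡ F))) detF))
  norm : abs (relNorm F″) ≡ P * P
  norm = begin
    abs (relNorm F″)                             ≡⟨ cong abs (relNorm-periodic (geo 1 k ⊡ F) N (◂-periodic 1 c (geo 1 n) (geo-periodic 1 n (Dv.m∣m*n 1)))) ⟩
    abs (relNorm (geo 1 k ⊡ F))                  ≡⟨ cong abs (relNorm-⊡ (geo 1 k) F) ⟩
    abs (relNorm (geo 1 k) ⊗ relNorm F)          ≡⟨ ℤₚ.abs-* (relNorm (geo 1 k)) (relNorm F) ⟩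
    abs (relNorm (geo 1 k)) * abs (relNorm F)      ≡⟨ cong₂ _*_ (proj₂ (unit-abs (relNorm (geo (k * 1) k′)) (relNorm (geo 1 k)) unit)) normF ⟩
    1 * (P * P)                                ≡⟨ ℕₚ.*-identityˡ (P * P) ⟩
    P * P                                      ∎

-- Arithmetic of the adjustment and the choice of sign.

modular-inverse : ∀ k n → Coprime (suc k) n → ∃ λ k′ → ∃ λ w → k′ * suc k ≡ suc w × n ∣ w
modular-inverse k n coprime with coprime-Bézout coprime
... | Bézout.+- x y eq = x , y * n , sym eq , Dv.n∣m*n y
... | Bézout.-+ x y eq with x * suc k in xk≡
...   | zero  = 1 , k , ℕₚ.*-identityˡ (suc k) , Dv.∣-trans (Dv.divides y eq) (Dv.1∣ k)
-- Here `x * suc k = suc z` is -1 modulo `n`, so its square is 1: it equals `1 + z * (z + 2)`, and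
-- `n` divides `z + 2` by the Bézout identity.
...   | suc z = suc z * x , z * suc (suc z) ,
  trans (ℕₚ.*-assoc (suc z) x (suc k)) (trans (cong (suc z *_) xk≡) (square z)) ,
  Dv.∣n⇒∣m*n z (Dv.divides y eq)
  where
  square : ∀ z → suc z * suc z ≡ suc (z * suc (suc z))
  square = ℕ-solve-∀

odd-shape : ∀ n → ¬ (2 ∣ n) → ∃ λ s → n ≡ suc (s * 2)
odd-shape zero          2∤n = contradiction (2 Dv.∣0) 2∤n
odd-shape (suc zero)    2∤n = 0 , refl
odd-shape (suc (suc n)) 2∤n with odd-shape n (λ 2∣n → 2∤n (Dv.∣m∣n⇒∣m+n Dv.∣-refl 2∣n))
... | s , refl = suc s , refl

InS-± : ∀ n → ¬ (2 ∣ n) → ∀ F x → circDet n F ≡ x ⊎ circDet n F ≡ ⊖ x → InS n x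
InS-± n 2∤n F x (inj₁ eq) = subst (InS n) eq (det-ev∈S n F)
InS-± n 2∤n F x (inj₂ eq) = subst (InS n) (begin
  circDet n (-1ℤ ◂ F)                     ≡⟨ det-cong n (ev-◂ -1ℤ F) ⟩
  det n (λ i k → -1ℤ ⊗ ev n F i k)        ≡⟨ det-scale n -1ℤ (ev n F) ⟩
  -1ℤ ℤ.^ n ⊗ circDet n F                 ≡⟨ cong₂ _⊗_ (power (odd-shape n 2∤n)) eq ⟩
  -1ℤ ⊗ ⊖ x                               ≡⟨ double x ⟩
  x                                       ∎) (det-ev∈S n (-1ℤ ◂ F))
  where
  double : ∀ x → -1ℤ ⊗ ⊖ x ≡ x
  double = solve-∀
  even : ∀ s → -1ℤ ℤ.^ (s * 2) ≡ 1ℤ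
  even zero    = refl
  even (suc s) = cong (λ z → -1ℤ ⊗ (-1ℤ ⊗ z)) (even s)
  power : (∃ λ s → n ≡ suc (s * 2)) → -1ℤ ℤ.^ n ≡ -1ℤ
  power (s , refl) = cong (-1ℤ ⊗_) (even s)

coprime-product : ∀ {k P Q} → Coprime k P → Coprime k Q → Coprime k (P * Q)
coprime-product {k} {P} {Q} kP kQ {i} (i∣k , i∣PQ) = kQ (i∣k , coprime-divisor iP i∣PQ)
  where
  iP : Coprime i P
  iP (j∣i , j∣P) = kP (Dv.∣-trans j∣i i∣k , j∣P)

-- Chinese remainder theorem: `suc k` is chosen to be 1 modulo `P` and `b m` modulo `Q`, where `b`
-- inverts `a`. Coprimality with `P` is then immediate; coprimality with `Q` follows because a
-- common divisor would divide `m`.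
solve-congruence : ∀ P-1 Q-1 → let P = suc P-1; Q = suc Q-1 in Coprime P Q → ∀ a b e → a ⊗ b ≡ 1ℤ ⊕ + Q ⊗ e →
  ∀ m → Coprime (abs m) Q →
  ∃ λ k → ∃ λ c → Coprime (suc k) (P * Q) × + suc k ⊗ a ⊕ c ⊗ + Q ≡ m
solve-congruence P-1 Q-1 coprime a b e ab≡ m mQ with modular-inverse P-1 (suc Q-1) coprime
... | P′ , w , P′P≡ , divides v w≡ = k , c , coprime-product {suc k} {P} {Q} kP kQ , solution
  where
  P Q t s z k : ℕ
  P = suc P-1
  Q = suc Q-1
  t = (b ⊗ m) ℤ.%ℕ Q
  -- A natural number congruent to `t - 1` modulo `Q`, so that `1 + P′ * P * s` is congruent to `t`.
  s = t + Q-1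
  z = 1 + v * s
  k = P′ * P * s
  u c : ℤ
  u = (b ⊗ m) ℤ./ℕ Q
  -- The value forced by the required equation, once `suc k = t + Q z`, `b m = t + u Q` and
  -- `a b = 1 + Q e` are substituted.
  c = a ⊗ u ⊝ a ⊗ + z ⊝ e ⊗ m
  k≡ : suc k ≡ t + Q * z
  k≡ = trans (cong (λ y → suc (y * s)) (trans P′P≡ (cong suc w≡))) (expand v t Q-1)
    where
    expand : ∀ v t q → suc (suc (v * suc q) * (t + q)) ≡ t + suc q * (1 + v * (t + q))
    expand = ℕ-solve-∀
  solution : + suc k ⊗ a ⊕ c ⊗ + Q ≡ m
  solution = begin
    + suc k ⊗ a ⊕ c ⊗ + Q
      ≡⟨ cong (λ y → y ⊗ a ⊕ c ⊗ + Q) (trans (cong +_ k≡) (cong (+ t ⊕_) (ℤₚ.pos-* Q z))) ⟩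
    (+ t ⊕ + Q ⊗ + z) ⊗ a ⊕ c ⊗ + Q
      ≡⟨ regroup (+ t) (+ Q) (+ z) a u e m ⟩
    a ⊗ (+ t ⊕ u ⊗ + Q) ⊝ e ⊗ m ⊗ + Q
      ≡⟨ cong (λ y → a ⊗ y ⊝ e ⊗ m ⊗ + Q) (sym (ℤDM.a≡a%ℕn+[a/ℕn]*n (b ⊗ m) Q)) ⟩
    a ⊗ (b ⊗ m) ⊝ e ⊗ m ⊗ + Q
      ≡⟨ cong (_⊝ e ⊗ m ⊗ + Q) (trans (sym (ℤₚ.*-assoc a b m)) (cong (_⊗ m) ab≡)) ⟩
    (1ℤ ⊕ + Q ⊗ e) ⊗ m ⊝ e ⊗ m ⊗ + Q
      ≡⟨ finish (+ Q) e m ⟩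
    m ∎
    where
    regroup : ∀ t q z a u e m → (t ⊕ q ⊗ z) ⊗ a ⊕ (a ⊗ u ⊝ a ⊗ z ⊝ e ⊗ m) ⊗ q ≡ a ⊗ (t ⊕ u ⊗ q) ⊝ e ⊗ m ⊗ q
    regroup = solve-∀
    finish : ∀ q e m → (1ℤ ⊕ q ⊗ e) ⊗ m ⊝ e ⊗ m ⊗ q ≡ m
    finish = solve-∀
  kP : Coprime (suc k) P
  kP {i} (i∣1+k , i∣P) = Dv.∣1⇒≡1 (Dv.∣m+n∣m⇒∣n (subst (i ∣_) (ℕₚ.+-comm 1 k) i∣1+k) (Dv.∣m⇒∣m*n s (Dv.∣n⇒∣m*n P′ i∣P)))
  kQ : Coprime (suc k) Q
  kQ {i} (i∣1+k , i∣Q) = mQ (ℤD.∣⇒∣ᵤ {+ i} {m} (subst (ℤD._∣_ (+ i)) solution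
    (ℤD.∣m∣n⇒∣m+n (ℤD.∣m⇒∣m*n a (ℤD.∣ᵤ⇒∣ {+ i} {+ suc k} i∣1+k)) (ℤD.∣n⇒∣m*n c (ℤD.∣ᵤ⇒∣ {+ i} {+ Q} i∣Q)))) , i∣Q)

Covers : ℕ → ℕ → Set
Covers P Q = (m : ℤ) → gcd m (+ Q) ≡ + 1 → InS (P * Q) (+ (P ^ 3) ⊗ m)

-- The adjusted value at 1 is `P m`, and `σ` is plus or minus `P * P`; the product is the desired
-- number up to sign.
cube-± : ∀ {n} P Q → n ≡ P * Q → ¬ (2 ∣ n) → ∀ F a k c m → ε F ≡ + P ⊗ a → + k ⊗ a ⊕ c ⊗ + Q ≡ m → ∀ F″ →
  (∃ λ σ → abs σ ≡ P * P × circDet n F″ ≡ σ ⊗ (+ k ⊗ ε F ⊕ c ⊗ + n)) → InS n (+ (P ^ 3) ⊗ m)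
cube-± {n} P Q n≡PQ 2∤n F a k c m εF≡ ka+cQ≡m F″ (σ , ∣σ∣≡ , det≡) =
  InS-± n 2∤n F″ (+ (P ^ 3) ⊗ m) (signs (ℤₚ.+∣i∣≡i⊎+∣i∣≡-i σ))
  where
  augmentation : + k ⊗ ε F ⊕ c ⊗ + n ≡ + P ⊗ m
  augmentation = begin
    + k ⊗ ε F ⊕ c ⊗ + n                      ≡⟨ cong₂ (λ x y → + k ⊗ x ⊕ c ⊗ y) εF≡ (trans (cong +_ n≡PQ) (ℤₚ.pos-* P Q)) ⟩
    + k ⊗ (+ P ⊗ a) ⊕ c ⊗ (+ P ⊗ + Q)        ≡⟨ factor (+ k) (+ P) a c (+ Q) ⟩
    + P ⊗ (+ k ⊗ a ⊕ c ⊗ + Q)                ≡⟨ cong (+ P ⊗_) ka+cQ≡m ⟩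
    + P ⊗ m                                  ∎
    where
    factor : ∀ k p a c q → k ⊗ (p ⊗ a) ⊕ c ⊗ (p ⊗ q) ≡ p ⊗ (k ⊗ a ⊕ c ⊗ q)
    factor = solve-∀
  cube : + (P * P) ⊗ (+ P ⊗ m) ≡ + (P ^ 3) ⊗ m
  cube = trans (sym (ℤₚ.*-assoc (+ (P * P)) (+ P) m)) (cong (_⊗ m) (trans (sym (ℤₚ.pos-* (P * P) P)) (cong +_ (power P))))
    where
    power : ∀ p → p * p * p ≡ p * (p * (p * 1))
    power = ℕ-solve-∀
  value : ∀ {τ} → τ ≡ σ → circDet n F″ ≡ τ ⊗ (+ P ⊗ m)
  value refl = trans det≡ (cong (σ ⊗_) augmentation)
  signs : + abs σ ≡ σ ⊎ + abs σ ≡ ⊖ σ → circDet n F″ ≡ + (P ^ 3) ⊗ m ⊎ circDet n F″ ≡ ⊖ (+ (P ^ 3) ⊗ m)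
  signs (inj₁ eq) = inj₁ (trans (value (trans (cong +_ (sym ∣σ∣≡)) eq)) cube)
  signs (inj₂ eq) = inj₂ (trans (value (trans (cong (λ y → ⊖ (+ y)) (sym ∣σ∣≡)) (trans (cong ⊖_ eq) (ℤₚ.neg-involutive σ))))
    (trans (sym (ℤₚ.neg-distribˡ-* (+ (P * P)) (+ P ⊗ m))) (cong ⊖_ cube)))

-- The relation between `a` and `b` makes `F(1)/P` invertible modulo `Q`, so `solve-congruence`
-- supplies a multiplier and a correction reaching every admissible `m`. The multiplier is prime to
-- `P * Q`, as `circDet-adjust` demands.
covers : ∀ P Q → Coprime P Q → Q ≢ 1 → ¬ (2 ∣ P * Q) → ∀ F a b e → ε F ≡ + P ⊗ a → a ⊗ b ≡ 1ℤ ⊕ + Q ⊗ e →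
  abs (circDet (P * Q) F) ≡ P * P * abs (ε F) → Covers P Q
covers zero    Q       coprime Q≢1 2∤PQ = contradiction (2 Dv.∣0) 2∤PQ
covers P       zero    coprime Q≢1 2∤PQ = contradiction (Dv.∣n⇒∣m*n P (2 Dv.∣0)) 2∤PQ
covers P@(suc P-1) Q@(suc Q-1) coprime Q≢1 2∤PQ F a b e εF≡ ab≡ detF m gcd≡1 =
  conclude (solve-congruence P-1 Q-1 coprime a b e ab≡ m (gcd≡1⇒coprime (ℤₚ.+-injective gcd≡1))) refl detF
  where
  εF≢0 : ε F ≢ 0ℤ
  εF≢0 εF≡0 with ℤₚ.i*j≡0⇒i≡0∨j≡0 (+ P) (trans (sym εF≡) εF≡0)
  -- If `a` were zero, `a b = 1 + Q e` would make `Q` a unit of ℤ.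
  ... | inj₂ refl = Q≢1 (proj₁ (unit-abs (+ Q) (⊖ e) (trans (negate (+ Q) e) (cong (1ℤ ⊝_) (sym ab≡)))))
    where
    negate : ∀ q e → q ⊗ ⊖ e ≡ 1ℤ ⊝ (1ℤ ⊕ q ⊗ e)
    negate = solve-∀
  conclude : (∃ λ k → ∃ λ c → Coprime (suc k) (P * Q) × + suc k ⊗ a ⊕ c ⊗ + Q ≡ m) →
    ∀ {n} → n ≡ P * Q → abs (circDet n F) ≡ P * P * abs (ε F) → InS n (+ (P ^ 3) ⊗ m)
  conclude (k , c , kPQ , ka+cQ≡m) {n} n≡PQ detF = conclude′ (modular-inverse k n (subst (Coprime (suc k)) (sym n≡PQ) kPQ))
    where
    conclude′ : (∃ λ k′ → ∃ λ w → k′ * suc k ≡ suc w × n ∣ w) → InS n (+ (P ^ 3) ⊗ m)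
    conclude′ (k′ , w , k′k≡ , n∣w) = cube-± P Q n≡PQ (subst (λ n → ¬ (2 ∣ n)) (sym n≡PQ) 2∤PQ) F a (suc k) c m εF≡ ka+cQ≡m
      ((geo 1 (suc k) ⊡ F) ⊞ (c ◂ geo 1 n))
      (circDet-adjust (Q-1 + P-1 * Q) (trans n≡PQ (ℕₚ.+-comm 1 (Q-1 + P-1 * Q))) F P εF≢0 detF (suc k) k′ w k′k≡ n∣w c)

-- Certificates for n = 35 and n = 55

ev-take-drop : ∀ {n} s F (i k : Fin n) → ev n F i k ≡ ev n (take s F) i k ⊕ ev n (drop s F) (next^ s i) k
ev-take-drop {n} zero    F       i k = sym (ℤₚ.+-identityˡ (ev n F i k))
ev-take-drop     (suc s) []      i k = refl
ev-take-drop {n} (suc s) (c ∷ F) i k = trans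
  (cong (c ⊗ δ i k ⊕_) (ev-take-drop s F (next i) k))
  (sym (ℤₚ.+-assoc (c ⊗ δ i k) (ev n (take s F) (next i) k) (ev n (drop s F) (next^ s (next i)) k)))

-- Folds a coefficient list by xⁿ = 1, cutting off `f` blocks of length `n`. By `reduce-≈` the class
-- is right for every `f`; enough fuel only makes the list short.
reduce : ℕ → ℕ → Poly → Poly
reduce n zero    F = F
reduce n (suc f) F = take n F ⊞ reduce n f (drop n F)

reduce-≈ : ∀ n f F → reduce n f F ≈[ n ] F
reduce-≈ n zero    F i k = refl
reduce-≈ n (suc f) F i k = begin
  ev n (take n F ⊞ reduce n f (drop n F)) i k
    ≡⟨ ev-⊞ (take n F) (reduce n f (drop n F)) i k ⟩
  ev n (take n F) i k ⊕ ev n (reduce n f (drop n F)) i k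
    ≡⟨ cong (ev n (take n F) i k ⊕_) (trans (reduce-≈ n f (drop n F) i k)
         (cong (λ z → ev n (drop n F) z k) (sym (next^-period n i Dv.∣-refl)))) ⟩
  ev n (take n F) i k ⊕ ev n (drop n F) (next^ n i) k
    ≡⟨ ev-take-drop n F i k ⟨
  ev n F i k ∎

-- The second argument of reduce is fuel; 12 wraps cover every product formed in the certificates.
residue : ℕ → Poly → Poly → Poly
residue n B H = reduce n 12 H ⊞ (-1ℤ ◂ B)

residue-≈ : ∀ n B H → H ≈[ n ] B ⊞ residue n B H
residue-≈ n B H i k = sym (begin
  ev n (B ⊞ residue n B H) i k
    ≡⟨ ev-⊞ B (residue n B H) i k ⟩
  ev n B i k ⊕ ev n (residue n B H) i k
    ≡⟨ cong (ev n B i k ⊕_) (trans (ev-⊞ (reduce n 12 H) (-1ℤ ◂ B) i k) (cong₂ _⊕_ (reduce-≈ n 12 H i k) (ev-◂ -1ℤ B i k))) ⟩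
  ev n B i k ⊕ (ev n H i k ⊕ -1ℤ ⊗ ev n B i k)
    ≡⟨ cancel (ev n B i k) (ev n H i k) ⟩
  ev n H i k ∎)
  where
  cancel : ∀ b h → b ⊕ (h ⊕ -1ℤ ⊗ b) ≡ h
  cancel = solve-∀

-- An equality of coefficient lists, which for explicit polynomials is settled by computation with
-- `refl`.
PeriodicResidue : ℕ → ℕ → Poly → Poly → Set
PeriodicResidue n d B H = reduce n 1 (shift d (residue n B H)) ≡ residue n B H

residue-periodic : ∀ n d B H → PeriodicResidue n d B H → shift d (residue n B H) ≈[ n ] residue n B H
residue-periodic n d B H eq i k = trans (sym (reduce-≈ n 1 (shift d (residue n B H)) i k)) (cong (λ F → ev n F i k) eq)

-- The three checks say that `G` inverts `F` modulo elements of period `P`, that `F ⊡ U` is (1 - x)²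
-- modulo constant multiples of 1 + x + ... + x^{P-1}, and that `V` inverts `U` modulo the same.
certified : ∀ P-1 Q-1 → let P = suc P-1; Q = suc Q-1 in Coprime P Q → Q ≢ 1 → ¬ (2 ∣ P * Q) →
  ∀ F G U V a b e → ε F ≡ + P ⊗ a → a ⊗ b ≡ 1ℤ ⊕ + Q ⊗ e →
  PeriodicResidue (P * Q) P one (G ⊡ F) → PeriodicResidue P 1 (1-x ⊡ 1-x) (F ⊡ U) → PeriodicResidue P 1 one (V ⊡ U) →
  Covers P Q
certified P-1 Q-1 coprime Q≢1 2∤PQ F G U V a b e εF≡ ab≡ check₀ check₁ check₂ =
  covers P Q coprime Q≢1 2∤PQ F a b e εF≡ ab≡ (trans
    (circDet-unit (Q-1 * P) P-1 (Dv.n∣m*n Q-1) (trans (ℕₚ.*-comm P Q) (ℕₚ.+-comm P (Q-1 * P))) F G (residue (P * Q) one (G ⊡ F))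
      (residue-periodic (P * Q) P one (G ⊡ F) check₀) (residue-≈ (P * Q) one (G ⊡ F)))
    (circDet-[1-x]² P-1 (ℕₚ.+-comm 1 P-1) F U V (residue P (1-x ⊡ 1-x) (F ⊡ U)) (residue P one (V ⊡ U))
      (residue-periodic P 1 (1-x ⊡ 1-x) (F ⊡ U) check₁) (residue-≈ P (1-x ⊡ 1-x) (F ⊡ U))
      (residue-periodic P 1 one (V ⊡ U) check₂) (residue-≈ P one (V ⊡ U))))
  where
  P Q : ℕ
  P = suc P-1
  Q = suc Q-1

-- With z = xᵖ, y = x^{βq} where βq ≡ 1 mod p, and Φ(t) = 1 + t + … + t^{q-1}, the F below are
-- (1 - zy)(1 - z⁻¹y)(1 + y + … + y^{k-1}) + s(z)(1 + y + … + y^{p-1}), where k and s are such that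
-- k(1 - z)(1 - z⁻¹) + p s(z) is a unit modulo Φ(z), found among the products of cyclotomic units.
-- G inverts F modulo Φ(z), and U inverts V = 1 + x + … + x^{k-1} modulo 1 + x + … + x^{p-1}.

covers-5-7 : Covers 5 7
covers-5-7 = certified 4 6 (from-yes (coprime? 5 7)) (λ ()) (from-no (2 ∣? 35))
  -- In ℤ[x]/(x⁵ - 1) the product of the two geometric sums is `geo 1 6`, and 6 = 1 + 5. The
  -- integers record F(1) = 5 · (-3) and (-3) · 2 = 1 + 7 · (-1).
  F G (geo 3 2) (geo 1 3) -[1+ 2 ] (+ 2) -[1+ 0 ] refl refl refl refl refl
  where
  F G : Poly
  F =
    0ℤ ∷ 0ℤ ∷ -1ℤ ∷ -1ℤ ∷ -1ℤ ∷ 0ℤ ∷ 0ℤ ∷ 1ℤ ∷ 0ℤ ∷ 0ℤ ∷ -1ℤ ∷ -1ℤ ∷ -1ℤ ∷ 0ℤ ∷ 0ℤ ∷ 0ℤ ∷ -1ℤ ∷ -1ℤ ∷ -1ℤ ∷ 0ℤ ∷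
    0ℤ ∷ 0ℤ ∷ 0ℤ ∷ -1ℤ ∷ -1ℤ ∷ -1ℤ ∷ -1ℤ ∷ 0ℤ ∷ 0ℤ ∷ 0ℤ ∷ 0ℤ ∷ -1ℤ ∷ -1ℤ ∷ -1ℤ ∷ 0ℤ ∷ []
  G =
    0ℤ ∷ 0ℤ ∷ -1ℤ ∷ -1ℤ ∷ 1ℤ ∷ 0ℤ ∷ 0ℤ ∷ 1ℤ ∷ 0ℤ ∷ -1ℤ ∷ 0ℤ ∷ 0ℤ ∷ -1ℤ ∷ 0ℤ ∷ 1ℤ ∷ 0ℤ ∷ 0ℤ ∷ 1ℤ ∷ -1ℤ ∷ -1ℤ ∷
    0ℤ ∷ 0ℤ ∷ 0ℤ ∷ 0ℤ ∷ 1ℤ ∷ 0ℤ ∷ 0ℤ ∷ 0ℤ ∷ -1ℤ ∷ 0ℤ ∷ 0ℤ ∷ 0ℤ ∷ 1ℤ ∷ 0ℤ ∷ 0ℤ ∷ []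

covers-7-5 : Covers 7 5
covers-7-5 = certified 6 4 (from-yes (coprime? 7 5)) (λ ()) (from-no (2 ∣? 35))
  F G (geo 2 4) (geo 1 2) (+ 4) -[1+ 0 ] -[1+ 0 ] refl refl refl refl refl
  where
  F G : Poly
  F =
    1ℤ ∷ 1ℤ ∷ 0ℤ ∷ 1ℤ ∷ 1ℤ ∷ 0ℤ ∷ 1ℤ ∷ 1ℤ ∷ 0ℤ ∷ 1ℤ ∷ 1ℤ ∷ 1ℤ ∷ 1ℤ ∷ 1ℤ ∷ 1ℤ ∷ 1ℤ ∷ 1ℤ ∷ 1ℤ ∷ 1ℤ ∷ 1ℤ ∷
    0ℤ ∷ 1ℤ ∷ 0ℤ ∷ 0ℤ ∷ 1ℤ ∷ 0ℤ ∷ 1ℤ ∷ 1ℤ ∷ 1ℤ ∷ 1ℤ ∷ 1ℤ ∷ 1ℤ ∷ 1ℤ ∷ 1ℤ ∷ 1ℤ ∷ []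
  G =
    1ℤ ∷ 0ℤ ∷ -[1+ 1 ] ∷ 1ℤ ∷ 0ℤ ∷ 0ℤ ∷ 0ℤ ∷ -1ℤ ∷ 1ℤ ∷ 0ℤ ∷ -1ℤ ∷ 0ℤ ∷ 0ℤ ∷ 0ℤ ∷ 0ℤ ∷ -1ℤ ∷ 0ℤ ∷ 1ℤ ∷ -1ℤ ∷ 0ℤ ∷
    0ℤ ∷ 0ℤ ∷ 1ℤ ∷ -[1+ 1 ] ∷ 0ℤ ∷ 1ℤ ∷ 0ℤ ∷ 0ℤ ∷ -1ℤ ∷ 0ℤ ∷ 1ℤ ∷ 0ℤ ∷ -1ℤ ∷ 0ℤ ∷ 0ℤ ∷ []

covers-5-11 : Covers 5 11
covers-5-11 = certified 4 10 (from-yes (coprime? 5 11)) (λ ()) (from-no (2 ∣? 55))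
  F G (geo 6 1) (geo 1 6) (+ 1) (+ 1) (+ 0) refl refl refl refl refl
  where
  F G : Poly
  F =
    0ℤ ∷ 0ℤ ∷ 1ℤ ∷ 0ℤ ∷ -1ℤ ∷ 1ℤ ∷ 0ℤ ∷ -1ℤ ∷ 0ℤ ∷ 1ℤ ∷ 0ℤ ∷ -1ℤ ∷ 0ℤ ∷ 1ℤ ∷ 0ℤ ∷ -1ℤ ∷ 0ℤ ∷ 1ℤ ∷ -1ℤ ∷ 0ℤ ∷
    1ℤ ∷ 0ℤ ∷ 0ℤ ∷ 0ℤ ∷ 1ℤ ∷ 0ℤ ∷ -1ℤ ∷ 1ℤ ∷ 1ℤ ∷ -1ℤ ∷ 0ℤ ∷ 1ℤ ∷ 0ℤ ∷ -1ℤ ∷ 0ℤ ∷ 1ℤ ∷ 0ℤ ∷ -1ℤ ∷ 1ℤ ∷ 1ℤ ∷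
    -1ℤ ∷ 0ℤ ∷ 1ℤ ∷ 0ℤ ∷ -1ℤ ∷ 0ℤ ∷ 1ℤ ∷ 0ℤ ∷ -1ℤ ∷ 1ℤ ∷ 1ℤ ∷ -1ℤ ∷ 0ℤ ∷ 1ℤ ∷ 0ℤ ∷ []
  G =
    + 2 ∷ 1ℤ ∷ 1ℤ ∷ 0ℤ ∷ 0ℤ ∷ -1ℤ ∷ -1ℤ ∷ -1ℤ ∷ 0ℤ ∷ + 2 ∷ 1ℤ ∷ + 2 ∷ 1ℤ ∷ 1ℤ ∷ 0ℤ ∷ 0ℤ ∷ -1ℤ ∷ -1ℤ ∷ 0ℤ ∷ 0ℤ ∷
    1ℤ ∷ 1ℤ ∷ + 2 ∷ 1ℤ ∷ + 2 ∷ 0ℤ ∷ -1ℤ ∷ -1ℤ ∷ -1ℤ ∷ 0ℤ ∷ 0ℤ ∷ 1ℤ ∷ 1ℤ ∷ + 2 ∷ + 2 ∷ 1ℤ ∷ 0ℤ ∷ -1ℤ ∷ -1ℤ ∷ -1ℤ ∷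
    0ℤ ∷ 0ℤ ∷ 1ℤ ∷ 1ℤ ∷ + 2 ∷ 1ℤ ∷ 1ℤ ∷ 0ℤ ∷ 0ℤ ∷ -1ℤ ∷ -1ℤ ∷ -1ℤ ∷ 0ℤ ∷ 1ℤ ∷ + 2 ∷ []

covers-11-5 : Covers 11 5
covers-11-5 = certified 10 4 (from-yes (coprime? 11 5)) (λ ()) (from-no (2 ∣? 55))
  F G (geo 8 7) (geo 1 8) (+ 1) (+ 1) (+ 0) refl refl refl refl refl
  where
  F G : Poly
  F =
    0ℤ ∷ 0ℤ ∷ 0ℤ ∷ 0ℤ ∷ 0ℤ ∷ 1ℤ ∷ 0ℤ ∷ 0ℤ ∷ 0ℤ ∷ 1ℤ ∷ -1ℤ ∷ 1ℤ ∷ 0ℤ ∷ 0ℤ ∷ 0ℤ ∷ 1ℤ ∷ 0ℤ ∷ 0ℤ ∷ 0ℤ ∷ 0ℤ ∷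
    0ℤ ∷ 1ℤ ∷ 0ℤ ∷ 0ℤ ∷ 0ℤ ∷ 1ℤ ∷ 0ℤ ∷ 0ℤ ∷ 0ℤ ∷ 0ℤ ∷ 0ℤ ∷ 1ℤ ∷ 0ℤ ∷ 0ℤ ∷ 0ℤ ∷ 1ℤ ∷ 0ℤ ∷ 0ℤ ∷ 0ℤ ∷ 0ℤ ∷
    1ℤ ∷ 0ℤ ∷ 0ℤ ∷ 0ℤ ∷ 1ℤ ∷ 0ℤ ∷ 0ℤ ∷ 0ℤ ∷ 0ℤ ∷ 0ℤ ∷ 1ℤ ∷ 0ℤ ∷ 0ℤ ∷ 0ℤ ∷ 1ℤ ∷ []
  G =
    0ℤ ∷ -1ℤ ∷ 0ℤ ∷ 0ℤ ∷ -1ℤ ∷ 0ℤ ∷ -1ℤ ∷ 0ℤ ∷ 0ℤ ∷ -1ℤ ∷ 0ℤ ∷ 0ℤ ∷ 0ℤ ∷ 0ℤ ∷ 0ℤ ∷ 1ℤ ∷ 1ℤ ∷ 0ℤ ∷ 0ℤ ∷ 1ℤ ∷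
    1ℤ ∷ 0ℤ ∷ 0ℤ ∷ 0ℤ ∷ 0ℤ ∷ 0ℤ ∷ -1ℤ ∷ 0ℤ ∷ 0ℤ ∷ -1ℤ ∷ 0ℤ ∷ -1ℤ ∷ 0ℤ ∷ 0ℤ ∷ -1ℤ ∷ 0ℤ ∷ 0ℤ ∷ 0ℤ ∷ 0ℤ ∷ -1ℤ ∷
    0ℤ ∷ 1ℤ ∷ 0ℤ ∷ 0ℤ ∷ 0ℤ ∷ 0ℤ ∷ 0ℤ ∷ 0ℤ ∷ 0ℤ ∷ 1ℤ ∷ 0ℤ ∷ -1ℤ ∷ 0ℤ ∷ 0ℤ ∷ 0ℤ ∷ []

-- The pairs (3, p) and (p, 3).

covers-3-p : ∀ p → Coprime 3 p → p ≢ 1 → ¬ (2 ∣ 3 * p) → Covers 3 p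
covers-3-p zero      coprime p≢1 2∤3p = contradiction (Dv.∣n⇒∣m*n 3 (2 Dv.∣0)) 2∤3p
covers-3-p p@(suc p-1) coprime p≢1 2∤3p = conclude (modular-inverse 2 p coprime)
  where
  conclude : (∃ λ k → ∃ λ w → k * 3 ≡ suc w × p ∣ w) → Covers 3 p
  conclude (k , w , 3k≡ , p∣w) = covers 3 p coprime p≢1 2∤3p (geo 3 3) 1ℤ 1ℤ 0ℤ refl
    (sym (cong (1ℤ ⊕_) (ℤₚ.*-zeroʳ (+ p))))
    -- In ℤ[x]/(x³ - 1) the polynomial `geo 3 3` is the constant 3, of determinant 27 = 3 · 3 ·
    -- F(1), found by computation. Its inverse on the quotient is `geo 9 k` with 3k congruent to 1
    -- modulo `p`.
    (circDet-unit (p-1 * 3) 2 (Dv.n∣m*n p-1) (trans (ℕₚ.*-comm 3 p) (ℕₚ.+-comm 3 (p-1 * 3)))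
      (geo 3 3) (geo 9 k) (shift 3 (geo 3 w)) (proj₂ unit) (proj₁ unit))
    where
    unit = geo-unit {3 * p} 3 3 k w 3k≡ (subst (_∣ w * 3) (ℕₚ.*-comm p 3) (Dv.*-monoˡ-∣ 3 p∣w))

-- Modulo 3 one has (1 - x)³ ≡ 1 - x³, and x is a cube in ℤ[x]/(xᵖ - 1), so there
-- (1 - x)³ / (1 - x³) makes sense as 1 - 3x [k]_{x³} with 3k ≡ 1 mod p.  It lifts to the element
-- 1 - x [k]_{x³} (1 + xᵖ + x²ᵖ), which is 1 modulo 1 + xᵖ + x²ᵖ.
module _ (p-1 : ℕ) where
  private
    p : ℕ
    p = suc p-1

    H : ℕ → Poly
    H k = 0ℤ ∷ (-1ℤ ◂ geo 3 k)

  cubeQuotient : ℕ → Poly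
  cubeQuotient k = one ⊞ (geo p 3 ⊡ H k)

  ev-H : ∀ n k (i l : Fin n) → ev n (H k) i l ≡ ⊖ ev n (geo 3 k) (next i) l
  ev-H n k i l = trans (ev-shift 1 (-1ℤ ◂ geo 3 k) i l) (trans (ev-◂ -1ℤ (geo 3 k) (next i) l) (ℤₚ.-1*i≡-i (ev n (geo 3 k) (next i) l)))

  -- For `n ∣ p` the power xᵖ acts trivially, so `geo p 3` acts as the scalar 3. This serves both
  -- `n = p` and the value at 1.
  ev-geo-p-3 : ∀ {n} → n ∣ p → ∀ G (i l : Fin n) → ev n (geo p 3 ⊡ G) i l ≡ + 3 ⊗ ev n G i l
  ev-geo-p-3 {n} n∣p G i l = trans (step 2) (trans (cong (ev n G i l ⊕_) (trans (step 1) (cong (ev n G i l ⊕_) (step 0))))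
    (triple (ev n G i l)))
    where
    step : ∀ j → ev n (geo p (suc j) ⊡ G) i l ≡ ev n G i l ⊕ ev n (geo p j ⊡ G) i l
    step j = trans (⊡-one⊞shift p (geo p j) G i l)
      (cong (λ z → ev n G i l ⊕ ev n (geo p j ⊡ G) z l) (next^-period p i n∣p))
    triple : ∀ x → x ⊕ (x ⊕ (x ⊕ 0ℤ)) ≡ + 3 ⊗ x
    triple = solve-∀

  ev-cubeQuotient : ∀ {n} → n ∣ p → ∀ k (i l : Fin n) →
    ev n (cubeQuotient k) i l ≡ δ i l ⊝ + 3 ⊗ ev n (geo 3 k) (next i) l
  ev-cubeQuotient {n} n∣p k i l = begin
    ev n (one ⊞ (geo p 3 ⊡ H k)) i l
      ≡⟨ ev-⊞ one (geo p 3 ⊡ H k) i l ⟩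
    ev n one i l ⊕ ev n (geo p 3 ⊡ H k) i l
      ≡⟨ cong₂ _⊕_ (ev-one i l) (trans (ev-geo-p-3 n∣p (H k) i l) (cong (+ 3 ⊗_) (ev-H n k i l))) ⟩
    δ i l ⊕ + 3 ⊗ ⊖ ev n (geo 3 k) (next i) l
      ≡⟨ cong (δ i l ⊕_) (sym (ℤₚ.neg-distribʳ-* (+ 3) (ev n (geo 3 k) (next i) l))) ⟩
    δ i l ⊝ + 3 ⊗ ev n (geo 3 k) (next i) l ∎

  ε-cubeQuotient : ∀ k → ε (cubeQuotient k) ≡ 1ℤ ⊝ + 3 ⊗ + k
  ε-cubeQuotient k = trans (ev-cubeQuotient {1} (Dv.1∣ p) k fzero fzero) (cong (λ z → 1ℤ ⊝ + 3 ⊗ z) (ε-geo 3 k))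

  -- Modulo multiples of `geo p 3` the polynomial is 1, so `one` serves as inverse. In ℤ[x]/(xᵖ - 1)
  -- it is 1 - 3xV, where V inverts U = 1 + x + x² modulo `N₂`; multiplying by U gives 1 + x + x² -
  -- 3x = (1 - x)² up to `N₁`.
  circDet-cubeQuotient : ∀ k w → k * 3 ≡ suc w → p ∣ w →
    abs (circDet (p * 3) (cubeQuotient k)) ≡ p * p * abs (ε (cubeQuotient k))
  circDet-cubeQuotient k w k3≡ p∣w = trans
    (circDet-unit (2 * p) p-1 (Dv.n∣m*n 2) (rearrange p) F one (geo p 3 ⊡ H k)
      (⊡-periodic p (geo p 3) (H k) (geo-periodic p 3 (Dv.∣-reflexive (ℕₚ.*-comm p 3))))
      (λ i l → trans (ev-⊡ one F i l) (trans (Σ-cong (p * 3) (λ j → cong (_⊗ ev (p * 3) F j l) (ev-one i j))) (Σ-δˡ (p * 3) i (λ j → ev (p * 3) F j l)))))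
    (circDet-[1-x]² p-1 (ℕₚ.+-comm 1 p-1) F U V N₁ N₂
      (◂-periodic 1 (⊖ + 3) (shift 1 N₂) (shift-cong 1 {shift 1 N₂} {N₂} (proj₂ unit)))
      FU≈ (proj₂ unit) (proj₁ unit))
    where
    F U V N₁ N₂ : Poly
    F  = cubeQuotient k
    U  = geo 1 3
    V  = geo 3 k
    N₂ = shift 1 (geo 1 w)
    N₁ = (⊖ + 3) ◂ shift 1 N₂
    rearrange : ∀ p → p * 3 ≡ 2 * p + p
    rearrange = ℕ-solve-∀
    unit : (V ⊡ U ≈[ p ] one ⊞ N₂) × (shift 1 N₂ ≈[ p ] N₂)
    unit = geo-unit {p} 1 3 k w k3≡ (Dv.∣m⇒∣m*n 1 p∣w)
    FU≈ : F ⊡ U ≈[ p ] (1-x ⊡ 1-x) ⊞ N₁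
    FU≈ i l = begin
      ev p (F ⊡ U) i l
        ≡⟨ ev-⊡ F U i l ⟩
      Σ-fin p (λ j → ev p F i j ⊗ ev p U j l)
        ≡⟨ Σ-cong p (λ j → trans (cong (_⊗ ev p U j l) (ev-cubeQuotient Dv.∣-refl k i j)) (distribute (δ i j) (ev p V (next i) j) (ev p U j l))) ⟩
      Σ-fin p (λ j → 1ℤ ⊗ (δ i j ⊗ ev p U j l) ⊕ (⊖ + 3) ⊗ (ev p V (next i) j ⊗ ev p U j l))
        ≡⟨ Σ-linear p 1ℤ (⊖ + 3) (λ j → δ i j ⊗ ev p U j l) (λ j → ev p V (next i) j ⊗ ev p U j l) ⟩
      1ℤ ⊗ Σ-fin p (λ j → δ i j ⊗ ev p U j l) ⊕ (⊖ + 3) ⊗ Σ-fin p (λ j → ev p V (next i) j ⊗ ev p U j l)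
        ≡⟨ cong₂ (λ x y → 1ℤ ⊗ x ⊕ (⊖ + 3) ⊗ y) (Σ-δˡ p i (λ j → ev p U j l))
             (trans (sym (ev-⊡ V U (next i) l)) (trans (proj₁ unit (next i) l)
               (trans (ev-⊞ one N₂ (next i) l) (cong (_⊕ ev p N₂ (next i) l) (ev-one (next i) l))))) ⟩
      1ℤ ⊗ ev p U i l ⊕ (⊖ + 3) ⊗ (δ (next i) l ⊕ ev p N₂ (next i) l)
        ≡⟨ collect (δ i l) (δ (next i) l) (δ (next (next i)) l) (ev p N₂ (next i) l) ⟩
      ev p (1-x ⊡ 1-x) i l ⊕ (⊖ + 3) ⊗ ev p N₂ (next i) l
        ≡⟨ cong (ev p (1-x ⊡ 1-x) i l ⊕_) (sym (trans (ev-◂ (⊖ + 3) (shift 1 N₂) i l) (cong ((⊖ + 3) ⊗_) (ev-shift 1 N₂ i l)))) ⟩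
      ev p (1-x ⊡ 1-x) i l ⊕ ev p N₁ i l
        ≡⟨ ev-⊞ (1-x ⊡ 1-x) N₁ i l ⟨
      ev p ((1-x ⊡ 1-x) ⊞ N₁) i l ∎
      where
      distribute : ∀ e v u → (e ⊝ + 3 ⊗ v) ⊗ u ≡ 1ℤ ⊗ (e ⊗ u) ⊕ (⊖ + 3) ⊗ (v ⊗ u)
      distribute = solve-∀
      collect : ∀ e₀ e₁ e₂ z →
        1ℤ ⊗ (1ℤ ⊗ e₀ ⊕ (1ℤ ⊗ e₁ ⊕ (1ℤ ⊗ e₂ ⊕ 0ℤ))) ⊕ (⊖ + 3) ⊗ (e₁ ⊕ z) ≡
        (1ℤ ⊗ e₀ ⊕ ((⊖ + 2) ⊗ e₁ ⊕ (1ℤ ⊗ e₂ ⊕ 0ℤ))) ⊕ (⊖ + 3) ⊗ z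
      collect = solve-∀

covers-p-3 : ∀ p → Coprime p 3 → ¬ (2 ∣ p * 3) → Covers p 3
covers-p-3 zero      coprime 2∤3p = contradiction (2 Dv.∣0) 2∤3p
covers-p-3 p@(suc p-1) coprime 2∤3p = conclude (modular-inverse 2 p (Cop.sym coprime))
  where
  conclude : (∃ λ k → ∃ λ w → k * 3 ≡ suc w × p ∣ w) → Covers p 3
  -- F(1) = 1 - 3k = -v p, so `a` is -v; the same identity, read modulo 3, shows that `p` inverts
  -- it, with quotient -k.
  conclude (k , w , k3≡ , p∣w@(divides v w≡)) = covers p 3 coprime (λ ()) 2∤3p (cubeQuotient p-1 k) (⊖ + v) (+ p) (⊖ + k)
    (trans augmentation (negateʳ (+ v) (+ p)))
    (sym (trans (negate₃ (+ k)) (trans (sym (ε-cubeQuotient p-1 k)) (trans augmentation (ℤₚ.neg-distribˡ-* (+ v) (+ p))))))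
    (circDet-cubeQuotient p-1 k w k3≡ p∣w)
    where
    negateʳ : ∀ v p → ⊖ (v ⊗ p) ≡ p ⊗ ⊖ v
    negateʳ = solve-∀
    negate₃ : ∀ k → 1ℤ ⊕ + 3 ⊗ ⊖ k ≡ 1ℤ ⊝ + 3 ⊗ k
    negate₃ = solve-∀
    augmentation : ε (cubeQuotient p-1 k) ≡ ⊖ (+ v ⊗ + p)
    augmentation = begin
      ε (cubeQuotient p-1 k)     ≡⟨ ε-cubeQuotient p-1 k ⟩
      1ℤ ⊝ + 3 ⊗ + k             ≡⟨ cong (1ℤ ⊝_) (trans (sym (ℤₚ.pos-* 3 k)) (cong +_ (trans (ℕₚ.*-comm 3 k) k3≡))) ⟩
      1ℤ ⊝ (1ℤ ⊕ + w)            ≡⟨ drop-one (+ w) ⟩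
      ⊖ + w                      ≡⟨ cong ⊖_ (trans (cong +_ w≡) (ℤₚ.pos-* v p)) ⟩
      ⊖ (+ v ⊗ + p)              ∎
      where
      drop-one : ∀ w → 1ℤ ⊝ (1ℤ ⊕ w) ≡ ⊖ w
      drop-one = solve-∀

-- Prime factors and assembly of the cases.

prime-∣ : ∀ {p q} → Prime p → Prime q → p ∣ q → p ≡ q
prime-∣ p-prime q-prime p∣q with prime⇒irreducible q-prime p∣q
... | inj₁ refl = contradiction p-prime ¬prime[1]
... | inj₂ p≡q  = p≡q

distinct-primes-coprime : ∀ {p q} → Prime p → Prime q → p ≢ q → Coprime p q
distinct-primes-coprime p-prime q-prime p≢q (i∣p , i∣q) with prime⇒irreducible p-prime i∣p
... | inj₁ i≡1  = i≡1
... | inj₂ refl = contradiction (prime-∣ p-prime q-prime i∣q) p≢q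

prime-factors : ∀ {p q} u v .{{_ : ℕ.NonZero u}} .{{_ : ℕ.NonZero v}} → Prime u → Prime v → Prime p → p * q ≡ u * v →
  (p ≡ u × q ≡ v) ⊎ (p ≡ v × q ≡ u)
prime-factors {p} {q} u v u-prime v-prime p-prime pq≡uv
  with euclidsLemma u v p-prime (divides q (trans (sym pq≡uv) (ℕₚ.*-comm p q)))
... | inj₁ p∣u with prime-∣ p-prime u-prime p∣u
...   | refl = inj₁ (refl , ℕₚ.*-cancelˡ-≡ q v u pq≡uv)
prime-factors {p} {q} u v u-prime v-prime p-prime pq≡uv
    | inj₂ p∣v with prime-∣ p-prime v-prime p∣v
...   | refl = inj₂ (refl , ℕₚ.*-cancelˡ-≡ q u v (trans pq≡uv (ℕₚ.*-comm u v)))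

covers-both : ∀ p q → Prime p → Prime q → p ≢ q → ¬ (2 ∣ p) → ¬ (2 ∣ q) →
  (q ≡ 3 ⊎ (p * q ≡ 35 ⊎ p * q ≡ 55)) → Covers p q × Covers q p
covers-both p q p-prime q-prime p≢q 2∤p 2∤q (inj₁ refl) =
  covers-p-3 p p⊥3 2∤p3 ,
  covers-3-p p (Cop.sym p⊥3) (λ { refl → ¬prime[1] p-prime }) (subst (λ n → ¬ (2 ∣ n)) (ℕₚ.*-comm p 3) 2∤p3)
  where
  p⊥3 : Coprime p 3
  p⊥3 = distinct-primes-coprime p-prime q-prime p≢q
  2∤p3 : ¬ (2 ∣ p * 3)
  2∤p3 2∣p3 with euclidsLemma p 3 prime[2] 2∣p3
  ... | inj₁ 2∣p = 2∤p 2∣p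
  ... | inj₂ 2∣3 = 2∤q 2∣3
covers-both p q p-prime _ _ _ _ (inj₂ (inj₁ pq≡35))
  with prime-factors 5 7 (from-yes (prime? 5)) (from-yes (prime? 7)) p-prime pq≡35
... | inj₁ (refl , refl) = covers-5-7 , covers-7-5
... | inj₂ (refl , refl) = covers-7-5 , covers-5-7
covers-both p q p-prime _ _ _ _ (inj₂ (inj₂ pq≡55))
  with prime-factors 5 11 (from-yes (prime? 5)) (from-yes (prime? 11)) p-prime pq≡55
... | inj₁ (refl , refl) = covers-5-11 , covers-11-5
... | inj₂ (refl , refl) = covers-11-5 , covers-5-11

theorem2 : (p q : ℕ) → Prime p → Prime q → p ≢ q → ¬ (2 ∣ p) → ¬ (2 ∣ q) →
    (q ≡ 3 ⊎ (p * q ≡ 35 ⊎ p * q ≡ 55)) →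
    (m : ℤ) →
    (gcd m (+ q) ≡ + 1 → InS (p * q) ((+ (p ^ 3)) ℤ.* m)) ×
    (gcd m (+ p) ≡ + 1 → InS (p * q) ((+ (q ^ 3)) ℤ.* m))
theorem2 p q p-prime q-prime p≢q 2∤p 2∤q cases m with covers-both p q p-prime q-prime p≢q 2∤p 2∤q cases
... | p³ , q³ = p³ m , λ gcd≡1 → subst (λ n → InS n ((+ (q ^ 3)) ℤ.* m)) (ℕₚ.*-comm q p) (q³ m gcd≡1)
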